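{- For all positive integers $N$, there exists an $N\times N$ real matrix $Q$ with first row $q_1$ satisfying $\|q_1\|_\infty=1$ and $\log_2(\gamma_2(Q))=\Theta(N)$, such that, for any online factorization algorithm for $Q$ in the row arrival model, there exists a time step $t$ for which the factorization value achieved by the algorithm by step $t$ (that is, $\max_{s\le t}\|\ell_s\|_2$) is at least $\sqrt{\frac12\log_2(\gamma_2(Q))}\cdot\gamma_2(Q_t)$, where $Q_t$ is the matrix of the first $t$ rows of $Q$.
   Context: For a matrix, $\|R\|_{1\to2}$ is the maximum $\ell_2$ norm of a column, $\|L\|_{2\to\infty}$ the maximum $\ell_2$ norm of a row, and $\gamma_2(A)=\min\{\|L\|_{2\to\infty}\|R\|_{1\to2}:LR=A\}$. Row arrival model: rows $q_1,q_2,\ldots\in\mathbb{R}^N$ arrive one at a time. The algorithm chooses an initial (possibly empty) matrix $R_0$ with $N$ columns; at step $t$, after receiving $q_t$, it forms $R_t$ by appending rows to $R_{t-1}$ and outputs a row vector $\ell_t$ with $\ell_tR_t=q_t$, where $\|R_t\|_{1\to2}\le1$ at every step. -}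

module Defs where

open import Algebra.Bundles using (CommutativeRing; Semiring)
open import Data.Fin.Base using (Fin; zero; suc; fromℕ<; inject≤)
open import Data.List.Base using (List; []; _∷_)
open import Data.Nat.Base as ℕ using (ℕ; zero; suc)
open import Data.Nat.Properties using (<⇒≤)
open import Data.Product.Base using (Σ-syntax; ∃; ∃₂; ∃-syntax; _×_; _,_; proj₁; proj₂)
open import Data.Sum.Base using (_⊎_; inj₁; inj₂)
open import Data.Vec.Functional using (Vector; foldr; _++_)
open import Function.Base using (_∘_)
open import Level using (0ℓ)
open import Relation.Binary.Bundles using (TotalOrder)
open import Relation.Binary.Core using (Rel)
open import Relation.Binary.Structures using (IsDecTotalOrder)
open import Relation.Nullary using (¬_; yes; no; contradiction)
open import Relation.Unary using (Pred)

import Algebra.Construct.NaturalChoice.Max as Max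
import Algebra.Definitions.RawMonoid as RawMonoid
import Algebra.Definitions.RawSemiring as RawSemiring
import Algebra.Properties.Group as GroupProperties
import Algebra.Properties.Ring as RingProperties
import Algebra.Solver.Ring.NaturalCoefficients.Default as NatSolver
import Relation.Binary.Construct.NonStrictToStrict as ToStrict
import Relation.Binary.Reasoning.PartialOrder as PosetReasoning

-- The classical second-order axioms of the real numbers, which determine them
-- up to isomorphism.  The order is decidable, as it is classically, and
-- suprema are asked for arbitrary predicates.  As in any field with a total
-- inverse operation, the value of 0# ⁻¹ is unspecified.

record CompleteOrderedField : Set₁ where
  infix  4 _≤_
  infix  8 _⁻¹ √_
  field
    commutativeRing : CommutativeRing 0ℓ 0ℓ

  open CommutativeRing commutativeRing public

  field
    _≤_             : Rel Carrier 0ℓ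
    isDecTotalOrder : IsDecTotalOrder _≈_ _≤_
    0≉1             : ¬ (0# ≈ 1#)
    _⁻¹             : Carrier → Carrier
    ⁻¹-inverseʳ     : ∀ x → ¬ (x ≈ 0#) → x * x ⁻¹ ≈ 1#
    +-monoˡ-≤       : ∀ z {x y} → x ≤ y → x + z ≤ y + z
    *-nonNeg        : ∀ {x y} → 0# ≤ x → 0# ≤ y → 0# ≤ x * y

  IsUpperBound : Pred Carrier 0ℓ → Carrier → Set
  IsUpperBound P u = ∀ x → P x → x ≤ u

  IsSupremum : Pred Carrier 0ℓ → Carrier → Set
  IsSupremum P s = IsUpperBound P s × (∀ u → IsUpperBound P u → s ≤ u)

  field
    complete : (P : Pred Carrier 0ℓ) → ∃ P → ∃ (IsUpperBound P) → ∃ (IsSupremum P)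

  open IsDecTotalOrder isDecTotalOrder public
    using (isTotalOrder; total; antisym; _≤?_; _≟_)
    renaming (refl to ≤-refl; trans to ≤-trans; reflexive to ≤-reflexive)

  totalOrder : TotalOrder 0ℓ 0ℓ 0ℓ
  totalOrder = record { isTotalOrder = isTotalOrder }

  open ToStrict _≈_ _≤_ public using (_<_)
  open Max totalOrder public using (_⊔_; x≤x⊔y; x≤y⊔x)
  open RawMonoid +-rawMonoid public using (sum) renaming (_×_ to _·_)
  open RawSemiring (Semiring.rawSemiring semiring) public using (_^_)

  fromℕ : ℕ → Carrier
  fromℕ n = n · 1#

  ∣_∣ : Carrier → Carrier
  ∣ x ∣ = x ⊔ (- x)

  private
    open GroupProperties +-group using () renaming (∙-cancelʳ to +-cancelʳ)
    open RingProperties ring using (-‿distribʳ-*; -‿distribˡ-*; -‿involutive)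
    open TotalOrder totalOrder using (poset)
    open PosetReasoning poset
    module S = NatSolver commutativeSemiring

    +-mono-≤ : ∀ {a b c d} → a ≤ b → c ≤ d → a + c ≤ b + d
    +-mono-≤ {a} {b} {c} {d} a≤b c≤d = begin
      a + c ≤⟨ +-monoˡ-≤ c a≤b ⟩
      b + c ≈⟨ +-comm b c ⟩
      c + b ≤⟨ +-monoˡ-≤ b c≤d ⟩
      d + b ≈⟨ +-comm d b ⟩
      b + d ∎

    +-nonNeg : ∀ {a b} → 0# ≤ a → 0# ≤ b → 0# ≤ a + b
    +-nonNeg 0≤a 0≤b = ≤-trans (≤-reflexive (sym (+-identityˡ 0#))) (+-mono-≤ 0≤a 0≤b)

    x≤x+y : ∀ {x y} → 0# ≤ y → x ≤ x + y
    x≤x+y {x} {y} 0≤y = ≤-trans (≤-reflexive (sym (+-identityʳ x))) (+-mono-≤ ≤-refl 0≤y)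

    +-cancelʳ-≤ : ∀ z {x y} → x + z ≤ y + z → x ≤ y
    +-cancelʳ-≤ z {x} {y} p = begin
      x               ≈⟨ shift x ⟨
      (x + z) + (- z) ≤⟨ +-monoˡ-≤ (- z) p ⟩
      (y + z) + (- z) ≈⟨ shift y ⟩
      y               ∎
      where
      shift : ∀ w → (w + z) + (- z) ≈ w
      shift w = trans (+-assoc w z (- z)) (trans (+-congˡ (-‿inverseʳ z)) (+-identityʳ w))

    x+y≤x⇒y≤0 : ∀ {x y} → x + y ≤ x → y ≤ 0#
    x+y≤x⇒y≤0 {x} {y} p = +-cancelʳ-≤ x (begin
      y + x  ≈⟨ +-comm y x ⟩
      x + y  ≤⟨ p ⟩
      x      ≈⟨ +-identityˡ x ⟨
      0# + x ∎)

    difference : ∀ {x y} → x ≤ y → ∃[ d ] 0# ≤ d × x + d ≈ y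
    difference {x} {y} x≤y = y + (- x)
      , (begin 0# ≈⟨ -‿inverseʳ x ⟨ x + (- x) ≤⟨ +-monoˡ-≤ (- x) x≤y ⟩ y + (- x) ∎)
      , trans (+-comm x _) (trans (+-assoc y _ x) (trans (+-congˡ (-‿inverseˡ x)) (+-identityʳ y)))

    *-monoʳ-≤ : ∀ {z x y} → 0# ≤ z → x ≤ y → z * x ≤ z * y
    *-monoʳ-≤ {z} {x} {y} 0≤z x≤y with difference x≤y
    ... | d , 0≤d , eq = begin
      z * x         ≤⟨ x≤x+y (*-nonNeg 0≤z 0≤d) ⟩
      z * x + z * d ≈⟨ distribˡ z x d ⟨
      z * (x + d)   ≈⟨ *-congˡ eq ⟩
      z * y         ∎

    square-mono : ∀ {x y} → 0# ≤ x → x ≤ y → x * x ≤ y * y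
    square-mono {x} {y} 0≤x x≤y = begin
      x * x ≤⟨ *-monoʳ-≤ 0≤x x≤y ⟩
      x * y ≈⟨ *-comm x y ⟩
      y * x ≤⟨ *-monoʳ-≤ (≤-trans 0≤x x≤y) x≤y ⟩
      y * y ∎

    square-nonNeg : ∀ x → 0# ≤ x * x
    square-nonNeg x with total 0# x
    ... | inj₁ 0≤x = *-nonNeg 0≤x 0≤x
    ... | inj₂ x≤0 = begin
      0#              ≤⟨ *-nonNeg 0≤-x 0≤-x ⟩
      (- x) * (- x)   ≈⟨ -‿distribʳ-* (- x) x ⟨
      - ((- x) * x)   ≈⟨ -‿cong (-‿distribˡ-* x x) ⟨
      - - (x * x)     ≈⟨ -‿involutive (x * x) ⟩
      x * x           ∎
      where
      0≤-x : 0# ≤ - x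
      0≤-x = begin
        0#         ≈⟨ -‿inverseʳ x ⟨
        x + (- x)  ≤⟨ +-monoˡ-≤ (- x) x≤0 ⟩
        0# + (- x) ≈⟨ +-identityˡ (- x) ⟩
        - x        ∎

    0≤1 : 0# ≤ 1#
    0≤1 = ≤-trans (square-nonNeg 1#) (≤-reflexive (*-identityˡ 1#))

    1≰0 : ¬ (1# ≤ 0#)
    1≰0 1≤0 = 0≉1 (antisym 0≤1 1≤0)

    -- e = d / (1 + y) for nonnegative d and y
    quotient : ∀ {d y} → 0# ≤ d → 0# ≤ y → ∃[ e ] 0# ≤ e × e * (1# + y) ≈ d
    quotient {d} {y} 0≤d 0≤y = d * D ⁻¹ , *-nonNeg 0≤d 0≤D⁻¹ , (begin-equality
      (d * D ⁻¹) * D ≈⟨ *-assoc d _ D ⟩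
      d * (D ⁻¹ * D) ≈⟨ *-congˡ (trans (*-comm _ D) DD⁻¹) ⟩
      d * 1#         ≈⟨ *-identityʳ d ⟩
      d              ∎)
      where
      D = 1# + y
      D≉0 : ¬ (D ≈ 0#)
      D≉0 D≈0 = 1≰0 (≤-trans (x≤x+y 0≤y) (≤-reflexive D≈0))
      DD⁻¹ : D * D ⁻¹ ≈ 1#
      DD⁻¹ = ⁻¹-inverseʳ D D≉0
      0≤D⁻¹ : 0# ≤ D ⁻¹
      0≤D⁻¹ = begin
        0#                ≤⟨ *-nonNeg (≤-trans 0≤1 (x≤x+y 0≤y)) (square-nonNeg (D ⁻¹)) ⟩
        D * (D ⁻¹ * D ⁻¹) ≈⟨ *-assoc D _ _ ⟨
        (D * D ⁻¹) * D ⁻¹ ≈⟨ *-congʳ DD⁻¹ ⟩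
        1# * D ⁻¹         ≈⟨ *-identityˡ _ ⟩
        D ⁻¹              ∎

    zero-factor : ∀ {e d D} → 0# ≤ e → e ≤ 0# → e * D ≈ d → d ≈ 0#
    zero-factor 0≤e e≤0 eq = trans (sym eq) (trans (*-congʳ (antisym e≤0 0≤e)) (zeroˡ _))

  squareRoot : ∀ x → 0# ≤ x → ∃[ r ] 0# ≤ r × r * r ≈ x
  squareRoot x 0≤x = s , 0≤s , antisym s²≤x x≤s²
    where
    P : Pred Carrier 0ℓ
    P r = r * r ≤ x

    P0 : P 0#
    P0 = ≤-trans (≤-reflexive (zeroˡ 0#)) 0≤x

    bounded : IsUpperBound P (1# + x)
    bounded r r²≤x with total r (1# + x)
    ... | inj₁ r≤u = r≤u
    ... | inj₂ u≤r = contradiction (x+y≤x⇒y≤0 (≤-trans lower r²≤x)) 1≰0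
      where
      lower : x + 1# ≤ r * r
      lower = begin
        x + 1#                                     ≤⟨ x≤x+y (+-nonNeg 0≤x (square-nonNeg x)) ⟩
        (x + 1#) + (x + x * x)                     ≈⟨ S.solve 1 (λ a → ((a S.:+ S.con 1) S.:+ (a S.:+ a S.:* a)) S.:=
                                                        ((S.con 1 S.:+ a) S.:* (S.con 1 S.:+ a))) refl x ⟩
        (1# + x) * (1# + x)                        ≤⟨ square-mono (+-nonNeg 0≤1 0≤x) u≤r ⟩
        r * r                                      ∎

    supremum : ∃ (IsSupremum P)
    supremum = complete P (0# , P0) (1# + x , bounded)

    s = proj₁ supremum
    upper = proj₁ (proj₂ supremum)
    least = proj₂ (proj₂ supremum)

    0≤s : 0# ≤ s
    0≤s = upper 0# P0

    0≤2s : 0# ≤ s + s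
    0≤2s = +-nonNeg 0≤s 0≤s

    s²≤x : s * s ≤ x
    s²≤x with total x (s * s)
    ... | inj₂ s²≤x = s²≤x
    ... | inj₁ x≤s² with difference x≤s²
    ...   | d , 0≤d , x+d≈s² with quotient 0≤d 0≤2s
    ...     | e , 0≤e , eD≈d = conclude (e≤0 (total s e))
      where
      conclude : e ≤ 0# → s * s ≤ x
      conclude e≤0 = ≤-reflexive (trans (sym x+d≈s²)
        (trans (+-congˡ (zero-factor 0≤e e≤0 eD≈d)) (+-identityʳ x)))

      u-equation : ∀ {u} → u + e ≈ s → u * u ≈ x + (e + e * e)
      u-equation {u} eq = +-cancelʳ (u * e + u * e + e * e) _ _ (begin-equality
        u * u + (u * e + u * e + e * e)
          ≈⟨ S.solve 2 (λ u e → u S.:* u S.:+ (u S.:* e S.:+ u S.:* e S.:+ e S.:* e)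
               S.:= (u S.:+ e) S.:* (u S.:+ e)) refl u e ⟩
        (u + e) * (u + e)              ≈⟨ *-cong eq eq ⟩
        s * s                          ≈⟨ x+d≈s² ⟨
        x + d                          ≈⟨ +-congˡ eD≈d ⟨
        x + e * (1# + (s + s))         ≈⟨ +-congˡ (*-congˡ (+-congˡ (+-cong eq eq))) ⟨
        x + e * (1# + ((u + e) + (u + e)))
          ≈⟨ S.solve 3 (λ x u e → x S.:+ e S.:* (S.con 1 S.:+ ((u S.:+ e) S.:+ (u S.:+ e)))
               S.:= (x S.:+ (e S.:+ e S.:* e)) S.:+ (u S.:* e S.:+ u S.:* e S.:+ e S.:* e)) refl x u e ⟩
        (x + (e + e * e)) + (u * e + u * e + e * e) ∎)

      e≤0 : s ≤ e ⊎ e ≤ s → e ≤ 0#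
      e≤0 (inj₂ e≤s) with difference e≤s
      ... | u , 0≤u , e+u≈s = x+y≤x⇒y≤0 (≤-trans (≤-reflexive (trans (+-comm u e) e+u≈s)) (least u u-upper))
        where
        u-upper : IsUpperBound P u
        u-upper r r²≤x with total r u
        ... | inj₁ r≤u = r≤u
        ... | inj₂ u≤r = ≤-trans (upper r r²≤x) (≤-reflexive (trans (sym e+u≈s) (trans (+-congʳ e≈0) (+-identityˡ u))))
          where
          e≤0′ : e ≤ 0#
          e≤0′ = ≤-trans (x≤x+y (square-nonNeg e)) (x+y≤x⇒y≤0 (begin
            x + (e + e * e) ≈⟨ u-equation (trans (+-comm u e) e+u≈s) ⟨
            u * u           ≤⟨ square-mono 0≤u u≤r ⟩
            r * r           ≤⟨ r²≤x ⟩
            x               ∎))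
          e≈0 : e ≈ 0#
          e≈0 = antisym e≤0′ 0≤e
      e≤0 (inj₁ s≤e) = begin
        e                     ≤⟨ x≤x+y (*-nonNeg 0≤e 0≤s) ⟩
        e + e * s             ≤⟨ x+y≤x⇒y≤0 (begin
          s * s + (e + e * s)   ≈⟨ S.solve 2 (λ s e → s S.:* s S.:+ (e S.:+ e S.:* s)
                                     S.:= (e S.:+ e S.:* s) S.:+ s S.:* s) refl s e ⟩
          (e + e * s) + s * s   ≤⟨ +-mono-≤ ≤-refl (*-monoʳ-≤ 0≤s s≤e) ⟩
          (e + e * s) + s * e   ≈⟨ S.solve 2 (λ s e → (e S.:+ e S.:* s) S.:+ s S.:* e
                                     S.:= e S.:* (S.con 1 S.:+ (s S.:+ s))) refl s e ⟩
          e * (1# + (s + s))    ≈⟨ eD≈d ⟩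
          d                     ≤⟨ x≤x+y 0≤x ⟩
          d + x                 ≈⟨ +-comm d x ⟩
          x + d                 ≈⟨ x+d≈s² ⟩
          s * s                 ∎) ⟩
        0#                    ∎

    x≤s² : x ≤ s * s
    x≤s² with total x (s * s)
    ... | inj₁ x≤s² = x≤s²
    ... | inj₂ s²≤x with difference s²≤x
    ...   | d , 0≤d , s²+d≈x with quotient 0≤d (+-nonNeg 0≤2s 0≤d)
    ...     | e , 0≤e , eE≈d = ≤-reflexive (trans (sym s²+d≈x)
                (trans (+-congˡ (zero-factor 0≤e e≤0 eE≈d)) (+-identityʳ (s * s))))
      where
      e≤1 : e ≤ 1#
      e≤1 with total e 1#
      ... | inj₁ p   = p
      ... | inj₂ 1≤e = contradiction (≤-trans (x≤x+y 0≤2s) (x+y≤x⇒y≤0 (begin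
        d + (1# + (s + s))            ≈⟨ S.solve 2 (λ d s → d S.:+ (S.con 1 S.:+ (s S.:+ s))
                                           S.:= (S.con 1 S.:+ ((s S.:+ s) S.:+ d)) S.:* S.con 1) refl d s ⟩
        (1# + ((s + s) + d)) * 1#     ≤⟨ *-monoʳ-≤ (+-nonNeg 0≤1 (+-nonNeg 0≤2s 0≤d)) 1≤e ⟩
        (1# + ((s + s) + d)) * e      ≈⟨ *-comm _ e ⟩
        e * (1# + ((s + s) + d))      ≈⟨ eE≈d ⟩
        d                             ∎))) 1≰0

      e≤0 : e ≤ 0#
      e≤0 = x+y≤x⇒y≤0 (upper (s + e) (begin
        (s + e) * (s + e)                      ≈⟨ S.solve 2 (λ s e → (s S.:+ e) S.:* (s S.:+ e)
                                                    S.:= (s S.:* s S.:+ e S.:* (s S.:+ s)) S.:+ e S.:* e) refl s e ⟩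
        (s * s + e * (s + s)) + e * e          ≤⟨ +-mono-≤ ≤-refl (*-monoʳ-≤ 0≤e e≤1) ⟩
        (s * s + e * (s + s)) + e * 1#         ≤⟨ x≤x+y (*-nonNeg 0≤e 0≤d) ⟩
        (s * s + e * (s + s)) + e * 1# + e * d ≈⟨ S.solve 3 (λ s e d →
                                                    (s S.:* s S.:+ e S.:* (s S.:+ s)) S.:+ e S.:* S.con 1 S.:+ e S.:* d
                                                    S.:= s S.:* s S.:+ e S.:* (S.con 1 S.:+ ((s S.:+ s) S.:+ d)))
                                                    refl s e d ⟩
        s * s + e * (1# + ((s + s) + d))       ≈⟨ +-congˡ eE≈d ⟩
        s * s + d                              ≈⟨ s²+d≈x ⟩
        x                                      ∎))

  -- √ x = 0 for negative x
  √_ : Carrier → Carrier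
  √ x = proj₁ (squareRoot (0# ⊔ x) (x≤x⊔y 0# x))

  ½ : Carrier
  ½ = fromℕ 2 ⁻¹

  -- x = log₂ y, that is, x = sup { r ∈ ℚ ∣ 2 ^ r ≤ y }.  For r = (a - b) / q
  -- with q > 0, the inequality 2 ^ r ≤ y says 2 ^ a ≤ y ^ q * 2 ^ b.
  IsLog₂ : Carrier → Carrier → Set
  IsLog₂ y x = 0# < y × IsSupremum RationalExponentBelow x
    where
    RationalExponentBelow : Pred Carrier 0ℓ
    RationalExponentBelow r = ∃[ a ] ∃[ b ] ∃[ q ]
      0 ℕ.< q × q · r ≈ fromℕ a - fromℕ b × fromℕ 2 ^ a ≤ y ^ q * fromℕ 2 ^ b

  -- Asymptotic as the index tends to infinity, for eventually nonnegative
  -- sequences.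
  IsΘ : (ℕ → Carrier) → (ℕ → Carrier) → Set
  IsΘ f g = ∃₂ λ c C → ∃[ n₀ ] 0# < c × 0# < C ×
    (∀ n → n₀ ℕ.≤ n → c * g n ≤ f n × f n ≤ C * g n)


module Factorization (ℝ : CompleteOrderedField) where

  open CompleteOrderedField ℝ

  Matrix : ℕ → ℕ → Set
  Matrix m n = Vector (Vector Carrier n) m

  private
    variable
      k m n : ℕ

  -- The starting value 0# is harmless for the nonnegative entries to which
  -- this is applied, and it gives empty matrices norm 0.
  maximum : Vector Carrier n → Carrier
  maximum = foldr _⊔_ 0#

  ‖_‖∞ : Vector Carrier n → Carrier
  ‖ v ‖∞ = maximum (λ j → ∣ v j ∣)

  ‖_‖₂ : Vector Carrier n → Carrier
  ‖ v ‖₂ = √ sum (λ j → v j * v j)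

  ‖_‖₁→₂ : Matrix m n → Carrier
  ‖ R ‖₁→₂ = maximum (λ j → ‖ (λ i → R i j) ‖₂)

  ‖_‖₂→∞ : Matrix m n → Carrier
  ‖ L ‖₂→∞ = maximum (λ i → ‖ L i ‖₂)

  _ᵛ*ᴹ_ : Vector Carrier k → Matrix k n → Vector Carrier n
  (ℓ ᵛ*ᴹ R) j = sum (λ i → ℓ i * R i j)

  _*ᴹ_ : Matrix m k → Matrix k n → Matrix m n
  (L *ᴹ R) i = L i ᵛ*ᴹ R

  infix 4 _≈ᵛ_ _≈ᴹ_
  _≈ᵛ_ : Vector Carrier n → Vector Carrier n → Set
  v ≈ᵛ w = ∀ j → v j ≈ w j

  _≈ᴹ_ : Matrix m n → Matrix m n → Set
  A ≈ᴹ B = ∀ i → A i ≈ᵛ B i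

  -- g = γ₂(A): g is the least value of ‖L‖₂→∞ * ‖R‖₁→₂ over all factorizations
  -- L R = A, of any inner dimension, and is attained.
  Isγ₂ : Matrix m n → Carrier → Set
  Isγ₂ {m} {n} A g =
    (∃[ k ] Σ[ L ∈ Matrix m k ] Σ[ R ∈ Matrix k n ]
       L *ᴹ R ≈ᴹ A × g ≈ ‖ L ‖₂→∞ * ‖ R ‖₁→₂)
    × (∀ k (L : Matrix m k) (R : Matrix k n) →
         L *ᴹ R ≈ᴹ A → g ≤ ‖ L ‖₂→∞ * ‖ R ‖₁→₂)

  firstRows : Matrix m n → (t : ℕ) → .(t ℕ.≤ m) → Matrix t n
  firstRows Q t t≤m i = Q (inject≤ i t≤m)

  -- A history lists the rows received so far, most recent first.
  History : ℕ → Set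
  History n = List (Vector Carrier n)

  history : Matrix m n → (t : ℕ) → .(t ℕ.≤ m) → History n
  history Q zero    _   = []
  history Q (suc t) t<m = Q (fromℕ< t<m) ∷ history Q t (<⇒≤ t<m)

  -- How the right factor evolves: R (q ∷ h) appends rows, depending on the
  -- history q ∷ h, below those of R h.
  record GrowingMatrix (n : ℕ) : Set where
    field
      initialSize : ℕ
      initial     : Matrix initialSize n
      newSize     : Vector Carrier n → History n → ℕ
      new         : (q : Vector Carrier n) (h : History n) → Matrix (newSize q h) n

    size : History n → ℕ
    size []      = initialSize
    size (q ∷ h) = size h ℕ.+ newSize q h

    R : (h : History n) → Matrix (size h) n
    R []      = initial
    R (q ∷ h) = R h ++ new q h

  record OnlineAlgorithm (n : ℕ) : Set where
    field
      growingMatrix : GrowingMatrix n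
    open GrowingMatrix growingMatrix public
    field
      ℓ : (q : Vector Carrier n) (h : History n) → Vector Carrier (size (q ∷ h))

    -- max_{s ≤ t} ‖ℓₛ‖₂ along a history of length t
    value : History n → Carrier
    value []      = 0#
    value (q ∷ h) = value h ⊔ ‖ ℓ q h ‖₂

  Factorizes : OnlineAlgorithm n → Matrix m n → Set
  Factorizes {m = m} A Q = ∀ t (t<m : t ℕ.< m) →
    let q = Q (fromℕ< t<m)
        h = history Q t (<⇒≤ t<m)
    in ℓ q h ᵛ*ᴹ R (q ∷ h) ≈ᵛ q × ‖ R (q ∷ h) ‖₁→₂ ≤ 1#
    where open OnlineAlgorithm A

-- Q = diag(d) H, where H is a Sylvester-Hadamard matrix of order M = 2 ^ k with
-- M ≤ N < 2 M, padded with zeros, and d₁² + ⋯ + dₜ² = 4 ^ (t - 1).  If L R = Q,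
-- then dᵢ M = (L R h)ᵢ for the i-th row h of H, so dᵢ² M² ≤ ‖Lᵢ‖² ‖R h‖² by
-- Cauchy-Schwarz, while the ‖R h‖² add up to at most M² ‖R‖₁→₂² by Parseval.
-- Hence γ₂(Qₜ) = 2 ^ (t - 1) for t ≤ M, attained by L = I, and log₂ γ₂(Q) = M - 1.
-- An online algorithm with ‖ℓₜ‖² ≤ ½ (M - 1) 4 ^ (t - 1) for all t ≤ M would
-- have ‖R hₜ‖² ≥ 3 M² / (2 (M - 1)) for its last R and all t ≤ M, because
-- dₜ² ≥ ¾ 4 ^ (t - 1); summing over t exceeds M².

module Submission where

open import Data.Fin.Base using (Fin; zero; suc; toℕ; fromℕ<; inject≤; splitAt; _↑ˡ_; _↑ʳ_)
open import Data.Fin.Properties using (any?; toℕ<n; toℕ-injective; toℕ-fromℕ<; toℕ-inject≤)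
open import Data.List.Base using (_∷_)
open import Data.Nat.Base as ℕ using (ℕ; zero; suc)
open import Data.Product.Base using (Σ-syntax; ∃; ∃-syntax; _×_; _,_; proj₁; proj₂)
open import Data.Sum.Base using (inj₁; inj₂)
open import Data.Vec.Functional using (Vector; _++_)
open import Data.Vec.Functional.Properties using (lookup-++ˡ; lookup-++ʳ)
open import Function.Base using (_∘_)
open import Relation.Binary.Bundles using (TotalOrder)
open import Relation.Binary.PropositionalEquality as ≡ using (_≡_)
open import Relation.Nullary.Decidable using (decidable-stable)
open import Relation.Nullary using (¬_; yes; no; contradiction)
open import Defs

import Algebra.Construct.NaturalChoice.MaxOp as MaxOp
import Algebra.Construct.NaturalChoice.Max as Max
import Algebra.Properties.CommutativeMonoid.Sum as CommutativeMonoidSum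
import Algebra.Properties.Ring as RingProperties
import Algebra.Properties.Semiring.Exp as Exp
import Algebra.Properties.Semiring.Mult as Mult
import Algebra.Properties.Semiring.Sum as SemiringSum
import Algebra.Solver.Ring.NaturalCoefficients.Default as NatSolver
import Data.Nat.Properties as ℕ
import Relation.Binary.Reasoning.PartialOrder as PosetReasoning

-- Padded and concatenated vectors.

-- Truncates v when n < m.
pad : {A : Set} → A → ∀ {m n} → Vector A m → Vector A n
pad a {zero}  v _       = a
pad a {suc m} v zero    = v zero
pad a {suc m} v (suc i) = pad a (v ∘ suc) i

pad-elim : ∀ {A : Set} (P : A → Set) {a m n} {v : Vector A m} → P a → (∀ i → P (v i)) → (i : Fin n) → P (pad a v i)
pad-elim P {m = zero}  pa pv _       = pa
pad-elim P {m = suc m} pa pv zero    = pv zero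
pad-elim P {m = suc m} pa pv (suc i) = pad-elim P pa (pv ∘ suc) i

pad-inject≤ : ∀ {A : Set} {a : A} {m n t} (v : Vector A m) .(t≤n : t ℕ.≤ n) .(t≤m : t ℕ.≤ m) (i : Fin t) →
              pad a v (inject≤ i t≤n) ≡ v (inject≤ i t≤m)
pad-inject≤ {m = suc m} {suc n} v t≤n t≤m zero    = ≡.refl
pad-inject≤ {m = suc m} {suc n} v t≤n t≤m (suc i) = pad-inject≤ (v ∘ suc) (ℕ.s≤s⁻¹ t≤n) (ℕ.s≤s⁻¹ t≤m) i

++-elim : ∀ {A : Set} (P : A → Set) {m n} {u : Vector A m} {v : Vector A n} →
          (∀ i → P (u i)) → (∀ i → P (v i)) → ∀ i → P ((u ++ v) i)
++-elim P {m} pu pv i with splitAt m i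
... | inj₁ j = pu j
... | inj₂ j = pv j

-- Arithmetic of ordered fields.

module OrderedField (ℝ : CompleteOrderedField) where

  open CompleteOrderedField ℝ hiding (zero)
  open CommutativeMonoidSum +-commutativeMonoid using (sum-cong-≋; sum-replicate)
  open Exp semiring using (^-homo-*; ^-assocʳ)
  open MaxOp (Max.maxOperator totalOrder) using (⊔-lub)
  open Mult semiring using (×-homo-+; ×-assoc-*; ×1-homo-*; ×-congʳ)
  open PosetReasoning (TotalOrder.poset totalOrder)
  open RingProperties ring using (-‿distribʳ-*; -‿distribˡ-*; -‿involutive)
  private
    module S = NatSolver commutativeSemiring

    variable
      m n : ℕ
      x y z w : Carrier

  +-mono-≤ : x ≤ y → z ≤ w → x + z ≤ y + w
  +-mono-≤ {x} {y} {z} {w} x≤y z≤w = begin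
    x + z ≤⟨ +-monoˡ-≤ z x≤y ⟩
    y + z ≈⟨ +-comm y z ⟩
    z + y ≤⟨ +-monoˡ-≤ y z≤w ⟩
    w + y ≈⟨ +-comm w y ⟩
    y + w ∎

  +-monoʳ-≤ : ∀ z {x y} → x ≤ y → z + x ≤ z + y
  +-monoʳ-≤ z = +-mono-≤ ≤-refl

  +-nonNeg : 0# ≤ x → 0# ≤ y → 0# ≤ x + y
  +-nonNeg 0≤x 0≤y = ≤-trans (≤-reflexive (sym (+-identityˡ 0#))) (+-mono-≤ 0≤x 0≤y)

  x≤x+y : 0# ≤ y → x ≤ x + y
  x≤x+y {y} {x} 0≤y = ≤-trans (≤-reflexive (sym (+-identityʳ x))) (+-monoʳ-≤ x 0≤y)

  +-cancelʳ-≤ : ∀ z {x y} → x + z ≤ y + z → x ≤ y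
  +-cancelʳ-≤ z {x} {y} x+z≤y+z = begin
    x               ≈⟨ shift x ⟨
    (x + z) + (- z) ≤⟨ +-monoˡ-≤ (- z) x+z≤y+z ⟩
    (y + z) + (- z) ≈⟨ shift y ⟩
    y               ∎
    where
    shift : ∀ w → (w + z) + (- z) ≈ w
    shift w = trans (+-assoc w z (- z)) (trans (+-congˡ (-‿inverseʳ z)) (+-identityʳ w))

  x≤y⇒0≤y-x : x ≤ y → 0# ≤ y - x
  x≤y⇒0≤y-x {x} {y} x≤y = begin
    0#    ≈⟨ -‿inverseʳ x ⟨
    x - x ≤⟨ +-monoˡ-≤ (- x) x≤y ⟩
    y - x ∎

  *-monoʳ-≤ : 0# ≤ z → x ≤ y → z * x ≤ z * y
  *-monoʳ-≤ {z} {x} {y} 0≤z x≤y = begin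
    z * x                 ≤⟨ x≤x+y (*-nonNeg 0≤z (x≤y⇒0≤y-x x≤y)) ⟩
    z * x + z * (y - x)   ≈⟨ distribˡ z x (y - x) ⟨
    z * (x + (y - x))     ≈⟨ *-congˡ (trans (+-comm x _) (trans (+-assoc y (- x) x) (trans (+-congˡ (-‿inverseˡ x)) (+-identityʳ y)))) ⟩
    z * y                 ∎

  *-monoˡ-≤ : 0# ≤ z → x ≤ y → x * z ≤ y * z
  *-monoˡ-≤ {z} {x} {y} 0≤z x≤y = begin
    x * z ≈⟨ *-comm x z ⟩
    z * x ≤⟨ *-monoʳ-≤ 0≤z x≤y ⟩
    z * y ≈⟨ *-comm z y ⟩
    y * z ∎

  *-mono-≤ : 0# ≤ y → 0# ≤ z → x ≤ y → z ≤ w → x * z ≤ y * w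
  *-mono-≤ 0≤y 0≤z x≤y z≤w = ≤-trans (*-monoˡ-≤ 0≤z x≤y) (*-monoʳ-≤ 0≤y z≤w)

  square-mono-≤ : 0# ≤ x → x ≤ y → x * x ≤ y * y
  square-mono-≤ 0≤x x≤y = *-mono-≤ (≤-trans 0≤x x≤y) 0≤x x≤y x≤y

  -x*-x≈x*x : ∀ x → - x * - x ≈ x * x
  -x*-x≈x*x x = begin-equality
    - x * - x     ≈⟨ -‿distribʳ-* (- x) x ⟨
    - (- x * x)   ≈⟨ -‿cong (-‿distribˡ-* x x) ⟨
    - - (x * x)   ≈⟨ -‿involutive (x * x) ⟩
    x * x         ∎

  square-nonNeg : ∀ x → 0# ≤ x * x
  square-nonNeg x with total 0# x
  ... | inj₁ 0≤x = *-nonNeg 0≤x 0≤x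
  ... | inj₂ x≤0 = ≤-trans (*-nonNeg 0≤-x 0≤-x) (≤-reflexive (-x*-x≈x*x x))
    where
    0≤-x : 0# ≤ - x
    0≤-x = ≤-trans (x≤y⇒0≤y-x x≤0) (≤-reflexive (+-identityˡ (- x)))

  0≤1 : 0# ≤ 1#
  0≤1 = ≤-trans (square-nonNeg 1#) (≤-reflexive (*-identityˡ 1#))

  1≰0 : ¬ (1# ≤ 0#)
  1≰0 1≤0 = 0≉1 (antisym 0≤1 1≤0)

  1≤x⇒x≉0 : 1# ≤ x → ¬ (x ≈ 0#)
  1≤x⇒x≉0 1≤x x≈0 = 1≰0 (≤-trans 1≤x (≤-reflexive x≈0))

  x+1≰x : ¬ (x + 1# ≤ x)
  x+1≰x {x} p = 1≰0 (+-cancelʳ-≤ x (begin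
    1# + x ≈⟨ +-comm 1# x ⟩
    x + 1# ≤⟨ p ⟩
    x      ≈⟨ +-identityˡ x ⟨
    0# + x ∎))

  -- `x ⁻¹` is `x` times the square of `x ⁻¹`, a product of nonnegative factors.
  ⁻¹-nonNeg : 0# ≤ x → ¬ (x ≈ 0#) → 0# ≤ x ⁻¹
  ⁻¹-nonNeg {x} 0≤x x≉0 = begin
    0#                ≤⟨ *-nonNeg 0≤x (square-nonNeg (x ⁻¹)) ⟩
    x * (x ⁻¹ * x ⁻¹) ≈⟨ *-assoc x _ _ ⟨
    (x * x ⁻¹) * x ⁻¹ ≈⟨ *-congʳ (⁻¹-inverseʳ x x≉0) ⟩
    1# * x ⁻¹         ≈⟨ *-identityˡ _ ⟩
    x ⁻¹              ∎

  *-cancelˡ-≤ : 0# ≤ z → ¬ (z ≈ 0#) → z * x ≤ z * y → x ≤ y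
  *-cancelˡ-≤ {z} {x} {y} 0≤z z≉0 zx≤zy = begin
    x              ≈⟨ cancel x ⟨
    z ⁻¹ * (z * x) ≤⟨ *-monoʳ-≤ (⁻¹-nonNeg 0≤z z≉0) zx≤zy ⟩
    z ⁻¹ * (z * y) ≈⟨ cancel y ⟩
    y              ∎
    where
    cancel : ∀ w → z ⁻¹ * (z * w) ≈ w
    cancel w = trans (sym (*-assoc _ z w))
      (trans (*-congʳ (trans (*-comm _ z) (⁻¹-inverseʳ z z≉0))) (*-identityˡ w))

  -- If `y ≤ x`, then `x * x ≤ y * y ≤ x * y`, and the factor `x`, nonnegative because `0 ≤ y ≤ x`,
  -- cancels unless it is 0.
  square-cancel-≤ : 0# ≤ y → x * x ≤ y * y → x ≤ y
  square-cancel-≤ {y} {x} 0≤y x²≤y² with total x y | x ≟ 0#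
  ... | inj₁ x≤y | _        = x≤y
  ... | inj₂ _   | yes x≈0  = ≤-trans (≤-reflexive x≈0) 0≤y
  ... | inj₂ y≤x | no x≉0   = *-cancelˡ-≤ (≤-trans 0≤y y≤x) x≉0 (≤-trans x²≤y² (*-monoˡ-≤ 0≤y y≤x))

  square-cancel-≈ : 0# ≤ x → 0# ≤ y → x * x ≈ y * y → x ≈ y
  square-cancel-≈ 0≤x 0≤y x²≈y² = antisym
    (square-cancel-≤ 0≤y (≤-reflexive x²≈y²)) (square-cancel-≤ 0≤x (≤-reflexive (sym x²≈y²)))

  2xy≤x²+y² : ∀ x y → x * y + x * y ≤ x * x + y * y
  2xy≤x²+y² x y = begin
    x * y + x * y                               ≈⟨ +-identityˡ _ ⟨
    0# + (x * y + x * y)                        ≤⟨ +-monoˡ-≤ _ (square-nonNeg (x - y)) ⟩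
    -- The solver works in commutative semirings, so `- y` enters as a variable `n`; the leftover
    -- multiple of `y + n` vanishes in the next step.
    (x - y) * (x - y) + (x * y + x * y)         ≈⟨ S.solve 3 (λ x y n → (x S.:+ n) S.:* (x S.:+ n) S.:+ (x S.:* y S.:+ x S.:* y)
                                                     S.:= (x S.:* x S.:+ n S.:* n) S.:+ (x S.:+ x) S.:* (y S.:+ n)) refl x y (- y) ⟩
    (x * x + - y * - y) + (x + x) * (y - y)     ≈⟨ +-cong (+-congˡ (-x*-x≈x*x y)) (trans (*-congˡ (-‿inverseʳ y)) (zeroʳ _)) ⟩
    (x * x + y * y) + 0#                        ≈⟨ +-identityʳ _ ⟩
    x * x + y * y                               ∎

  parallelogram : ∀ x y → (x + y) * (x + y) + (x - y) * (x - y) ≈ (x * x + y * y) + (x * x + y * y)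
  parallelogram x y = begin-equality
    (x + y) * (x + y) + (x - y) * (x - y)
      ≈⟨ S.solve 3 (λ x y n → (x S.:+ y) S.:* (x S.:+ y) S.:+ (x S.:+ n) S.:* (x S.:+ n)
           S.:= ((x S.:* x S.:+ y S.:* y) S.:+ (x S.:* x S.:+ n S.:* n)) S.:+ (x S.:+ x) S.:* (y S.:+ n)) refl x y (- y) ⟩
    ((x * x + y * y) + (x * x + - y * - y)) + (x + x) * (y - y)
      ≈⟨ +-cong (+-congˡ (+-congˡ (-x*-x≈x*x y))) (trans (*-congˡ (-‿inverseʳ y)) (zeroʳ _)) ⟩
    ((x * x + y * y) + (x * x + y * y)) + 0#
      ≈⟨ +-identityʳ _ ⟩
    (x * x + y * y) + (x * x + y * y) ∎

  ≰⇒≥ : ¬ (x ≤ y) → y ≤ x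
  ≰⇒≥ {x} {y} x≰y with total x y
  ... | inj₁ x≤y = contradiction x≤y x≰y
  ... | inj₂ y≤x = y≤x

  -- Square roots, natural numbers and binary logarithms.

  √-nonNeg : ∀ x → 0# ≤ √ x
  √-nonNeg x = proj₁ (proj₂ (squareRoot (0# ⊔ x) (x≤x⊔y 0# x)))

  √-square : 0# ≤ x → √ x * √ x ≈ x
  √-square {x} 0≤x = trans (proj₂ (proj₂ (squareRoot (0# ⊔ x) (x≤x⊔y 0# x))))
    (antisym (⊔-lub 0≤x ≤-refl) (x≤y⊔x 0# x))

  fromℕ-nonNeg : ∀ n → 0# ≤ fromℕ n
  fromℕ-nonNeg zero    = ≤-refl
  fromℕ-nonNeg (suc n) = +-nonNeg 0≤1 (fromℕ-nonNeg n)

  fromℕ-+ : ∀ m n → fromℕ (m ℕ.+ n) ≈ fromℕ m + fromℕ n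
  fromℕ-+ = ×-homo-+ 1#

  fromℕ-* : ∀ m n → fromℕ (m ℕ.* n) ≈ fromℕ m * fromℕ n
  fromℕ-* = ×1-homo-*

  fromℕ-mono-≤ : m ℕ.≤ n → fromℕ m ≤ fromℕ n
  fromℕ-mono-≤ {n = n} ℕ.z≤n = fromℕ-nonNeg n
  fromℕ-mono-≤ (ℕ.s≤s m≤n) = +-monoʳ-≤ 1# (fromℕ-mono-≤ m≤n)

  fromℕ-cancel-≤ : fromℕ m ≤ fromℕ n → m ℕ.≤ n
  fromℕ-cancel-≤ {m} {n} p with m ℕ.≤? n
  ... | yes m≤n = m≤n
  ... | no m≰n  = contradiction
    (≤-trans (≤-reflexive (+-comm _ 1#)) (≤-trans (fromℕ-mono-≤ (ℕ.≰⇒> m≰n)) p)) x+1≰x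

  1≤fromℕ-suc : ∀ n → 1# ≤ fromℕ (suc n)
  1≤fromℕ-suc n = x≤x+y (fromℕ-nonNeg n)

  fromℕ-suc≉0 : ∀ n → ¬ (fromℕ (suc n) ≈ 0#)
  fromℕ-suc≉0 n = 1≤x⇒x≉0 (1≤fromℕ-suc n)

  ·≈fromℕ* : ∀ n x → n · x ≈ fromℕ n * x
  ·≈fromℕ* n x = sym (trans (×-assoc-* n 1# x) (×-congʳ n (*-identityˡ x)))

  fromℕ-^ : ∀ m n → fromℕ m ^ n ≈ fromℕ (m ℕ.^ n)
  fromℕ-^ m zero    = sym (+-identityʳ 1#)
  fromℕ-^ m (suc n) = trans (*-congˡ (fromℕ-^ m n)) (sym (fromℕ-* m (m ℕ.^ n)))

  1≤2^n : ∀ n → 1# ≤ fromℕ 2 ^ n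
  1≤2^n n = begin
    1#              ≈⟨ +-identityʳ 1# ⟨
    fromℕ 1         ≤⟨ fromℕ-mono-≤ (ℕ.m^n>0 2 n) ⟩
    fromℕ (2 ℕ.^ n) ≈⟨ fromℕ-^ 2 n ⟨
    fromℕ 2 ^ n     ∎

  2^-cancel-≤ : ∀ m n → fromℕ 2 ^ m ≤ fromℕ 2 ^ n → m ℕ.≤ n
  2^-cancel-≤ m n p with m ℕ.≤? n
  ... | yes m≤n = m≤n
  ... | no m≰n  = contradiction (fromℕ-cancel-≤ (begin
    fromℕ (2 ℕ.^ m) ≈⟨ fromℕ-^ 2 m ⟨
    fromℕ 2 ^ m     ≤⟨ p ⟩
    fromℕ 2 ^ n     ≈⟨ fromℕ-^ 2 n ⟩
    fromℕ (2 ℕ.^ n) ∎)) (ℕ.<⇒≱ (ℕ.^-monoʳ-< 2 (ℕ.s≤s (ℕ.s≤s ℕ.z≤n)) (ℕ.≰⇒> m≰n)))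

  -- The supremum is attained at the exponent `(n - 0) / 1`. Any other admissible `(a - b) / q`
  -- satisfies `2 ^ a ≤ 2 ^ (n q + b)`, hence `a ≤ n q + b` by strict monotonicity of powers of 2 in
  -- ℕ.
  log₂-2^ : ∀ n → IsLog₂ (fromℕ 2 ^ n) (fromℕ n)
  log₂-2^ n = (≤-trans 0≤1 (1≤2^n n) , λ 0≈2^n → 1≤x⇒x≉0 (1≤2^n n) (sym 0≈2^n))
    , upper
    , λ u u-upper → u-upper (fromℕ n) (n , 0 , 1 , ℕ.s≤s ℕ.z≤n
        , trans (+-identityʳ _) (sym (trans (+-congˡ -0≈0) (+-identityʳ _)))
        , ≤-reflexive (sym (trans (*-identityʳ _) (*-identityʳ _))))
    where
    -0≈0 : - 0# ≈ 0#
    -0≈0 = trans (sym (+-identityˡ (- 0#))) (-‿inverseʳ 0#)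

    upper : IsUpperBound _ (fromℕ n)
    upper r (a , b , q@(suc q-1) , _ , qr≈a-b , 2^a≤2^nq+b) = *-cancelˡ-≤ (fromℕ-nonNeg q) (fromℕ-suc≉0 q-1) (begin
      fromℕ q * r                               ≈⟨ ·≈fromℕ* q r ⟨
      q · r                                     ≈⟨ qr≈a-b ⟩
      fromℕ a - fromℕ b                         ≤⟨ +-monoˡ-≤ _ (fromℕ-mono-≤ (2^-cancel-≤ a (n ℕ.* q ℕ.+ b) 2^a≤)) ⟩
      fromℕ (n ℕ.* q ℕ.+ b) - fromℕ b           ≈⟨ +-congʳ (fromℕ-+ (n ℕ.* q) b) ⟩
      (fromℕ (n ℕ.* q) + fromℕ b) - fromℕ b     ≈⟨ +-assoc _ _ _ ⟩
      fromℕ (n ℕ.* q) + (fromℕ b - fromℕ b)     ≈⟨ trans (+-congˡ (-‿inverseʳ _)) (+-identityʳ _) ⟩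
      fromℕ (n ℕ.* q)                           ≈⟨ fromℕ-* n q ⟩
      fromℕ n * fromℕ q                         ≈⟨ *-comm _ _ ⟩
      fromℕ q * fromℕ n                         ∎)
      where
      2^a≤ : fromℕ 2 ^ a ≤ fromℕ 2 ^ (n ℕ.* q ℕ.+ b)
      2^a≤ = begin
        fromℕ 2 ^ a                         ≤⟨ 2^a≤2^nq+b ⟩
        (fromℕ 2 ^ n) ^ q * fromℕ 2 ^ b     ≈⟨ *-congʳ (^-assocʳ (fromℕ 2) n q) ⟩
        fromℕ 2 ^ (n ℕ.* q) * fromℕ 2 ^ b   ≈⟨ ^-homo-* (fromℕ 2) (n ℕ.* q) b ⟨
        fromℕ 2 ^ (n ℕ.* q ℕ.+ b)           ∎

  -- Finite sums.

  sum-mono-≤ : {u v : Vector Carrier n} → (∀ i → u i ≤ v i) → sum u ≤ sum v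
  sum-mono-≤ {zero}  _   = ≤-refl
  sum-mono-≤ {suc n} u≤v = +-mono-≤ (u≤v zero) (sum-mono-≤ (u≤v ∘ suc))

  sum-nonNeg : {v : Vector Carrier n} → (∀ i → 0# ≤ v i) → 0# ≤ sum v
  sum-nonNeg {zero}  _   = ≤-refl
  sum-nonNeg {suc n} 0≤v = +-nonNeg (0≤v zero) (sum-nonNeg (0≤v ∘ suc))

  sum-const : ∀ n x → sum {n} (λ _ → x) ≈ fromℕ n * x
  sum-const n x = trans (sum-replicate n) (·≈fromℕ* n x)

  sum-inject≤-≤ : .(m≤n : m ℕ.≤ n) {v : Vector Carrier n} → (∀ i → 0# ≤ v i) →
                  sum (λ i → v (inject≤ {m} i m≤n)) ≤ sum v
  sum-inject≤-≤ {zero}          _   0≤v = sum-nonNeg 0≤v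
  sum-inject≤-≤ {suc m} {suc n} m≤n 0≤v = +-monoʳ-≤ _ (sum-inject≤-≤ (ℕ.s≤s⁻¹ m≤n) (0≤v ∘ suc))

  sum-split : ∀ m {n} (v : Vector Carrier (m ℕ.+ n)) →
              sum v ≈ sum (λ i → v (i ↑ˡ n)) + sum (λ i → v (m ↑ʳ i))
  sum-split zero    v = sym (+-identityˡ _)
  sum-split (suc m) v = trans (+-congˡ (sum-split m (v ∘ suc))) (sym (+-assoc _ _ _))

  sum-++ : ∀ {A : Set} (f : A → Carrier) (u : Vector A m) (v : Vector A n) →
           sum (f ∘ (u ++ v)) ≈ sum (f ∘ u) + sum (f ∘ v)
  sum-++ {m} f u v = trans (sum-split m _) (+-cong
    (sum-cong-≋ (λ i → reflexive (≡.cong f (lookup-++ˡ u v i))))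
    (sum-cong-≋ (λ i → reflexive (≡.cong f (lookup-++ʳ u v i)))))

  -- The summand `g` sees the index as well as the entry, so that the lemma covers inner products
  -- with a padded vector, squared norms, and sums over padded families of rows.
  sum-pad : ∀ {A : Set} {a : A} {m n} (g : Fin n → A → Carrier) → (∀ i → g i a ≈ 0#) →
            (v : Vector A m) .(m≤n : m ℕ.≤ n) →
            sum (λ i → g i (pad a v i)) ≈ sum (λ i → g (inject≤ i m≤n) (v i))
  sum-pad {m = zero} {n} g ga≈0 v m≤n = trans (sum-cong-≋ {n} ga≈0) (trans (sum-const n 0#) (zeroʳ _))
  sum-pad {m = suc m} {suc n} g ga≈0 v m≤n = +-congˡ (sum-pad (g ∘ suc) (ga≈0 ∘ suc) (v ∘ suc) (ℕ.s≤s⁻¹ m≤n))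

-- Inner products, matrix norms and the Cauchy-Schwarz inequality.

module Norms (ℝ : CompleteOrderedField) where

  open CompleteOrderedField ℝ hiding (zero)
  open Factorization ℝ
  open OrderedField ℝ
  open CommutativeMonoidSum +-commutativeMonoid using (sum-cong-≋; ∑-comm)
  open MaxOp (Max.maxOperator totalOrder) using (⊔-lub)
  open PosetReasoning (TotalOrder.poset totalOrder)
  open RingProperties ring using (-‿distribʳ-*; -1*x≈-x)
  open SemiringSum semiring using (*-distribˡ-sum; *-distribʳ-sum)
  private
    module S = NatSolver commutativeSemiring

    variable
      k m n : ℕ

  infix 8 _∙_
  _∙_ : Vector Carrier n → Vector Carrier n → Carrier
  u ∙ v = sum (λ j → u j * v j)

  ∙-nonNeg : (v : Vector Carrier n) → 0# ≤ v ∙ v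
  ∙-nonNeg v = sum-nonNeg (λ j → square-nonNeg (v j))

  ∙-++ : (x : Vector Carrier (m ℕ.+ n)) (u : Vector Carrier m) (v : Vector Carrier n) →
         x ∙ (u ++ v) ≈ (λ i → x (i ↑ˡ n)) ∙ u + (λ i → x (m ↑ʳ i)) ∙ v
  ∙-++ {m} {n} x u v = trans (sum-split m _) (+-cong
    (sum-cong-≋ (λ i → *-congˡ (reflexive (lookup-++ˡ u v i))))
    (sum-cong-≋ (λ i → *-congˡ (reflexive (lookup-++ʳ u v i)))))

  ∙-negʳ : (x v : Vector Carrier n) → x ∙ (λ i → - v i) ≈ - (x ∙ v)
  ∙-negʳ {n} x v = begin-equality
    x ∙ (λ i → - v i)            ≈⟨ sum-cong-≋ {n} (λ i → trans (sym (-‿distribʳ-* _ _)) (sym (-1*x≈-x _))) ⟩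
    sum (λ i → - 1# * (x i * v i)) ≈⟨ *-distribˡ-sum {n} (- 1#) _ ⟨
    - 1# * (x ∙ v)               ≈⟨ -1*x≈-x _ ⟩
    - (x ∙ v)                    ∎

  -- Induction on the length. In the expansion of `(a b + s)²`, the induction hypothesis bounds `s²`
  -- by `A B`, and the cross term `2 a b s` is at most `a² B + b² A`, the mixed terms of
  -- `(a² + A) (b² + B)`.
  cauchy-schwarz : (x y : Vector Carrier n) → (x ∙ y) * (x ∙ y) ≤ (x ∙ x) * (y ∙ y)
  cauchy-schwarz {zero}  x y = ≤-refl
  cauchy-schwarz {suc n} x y = begin
    (a * b + s) * (a * b + s)
      ≈⟨ S.solve 3 (λ a b s → (a S.:* b S.:+ s) S.:* (a S.:* b S.:+ s)
           S.:= ((a S.:* b) S.:* (a S.:* b) S.:+ s S.:* s) S.:+ ((a S.:* b) S.:* s S.:+ (a S.:* b) S.:* s)) refl a b s ⟩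
    ((a * b) * (a * b) + s * s) + (a * b * s + a * b * s)
      ≤⟨ +-mono-≤ (+-monoʳ-≤ _ ih) cross ⟩
    ((a * b) * (a * b) + A * B) + (a * a * B + b * b * A)
      ≈⟨ S.solve 4 (λ a b A B → ((a S.:* b) S.:* (a S.:* b) S.:+ A S.:* B) S.:+ (a S.:* a S.:* B S.:+ b S.:* b S.:* A)
           S.:= (a S.:* a S.:+ A) S.:* (b S.:* b S.:+ B)) refl a b A B ⟩
    (a * a + A) * (b * b + B) ∎
    where
    a = x zero
    b = y zero
    s = (x ∘ suc) ∙ (y ∘ suc)
    A = (x ∘ suc) ∙ (x ∘ suc)
    B = (y ∘ suc) ∙ (y ∘ suc)
    P = a * a * B
    R = b * b * A

    ih : s * s ≤ A * B
    ih = cauchy-schwarz (x ∘ suc) (y ∘ suc)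

    -- AM-GM applied to P and R, after squaring
    cross : a * b * s + a * b * s ≤ P + R
    cross = square-cancel-≤
      (+-nonNeg (*-nonNeg (square-nonNeg a) (∙-nonNeg (y ∘ suc))) (*-nonNeg (square-nonNeg b) (∙-nonNeg (x ∘ suc)))) (begin
      (a * b * s + a * b * s) * (a * b * s + a * b * s)
        ≈⟨ S.solve 2 (λ t s → (t S.:* s S.:+ t S.:* s) S.:* (t S.:* s S.:+ t S.:* s)
             S.:= ((t S.:+ t) S.:* (t S.:+ t)) S.:* (s S.:* s)) refl (a * b) s ⟩
      ((a * b + a * b) * (a * b + a * b)) * (s * s)
        ≤⟨ *-monoʳ-≤ (square-nonNeg _) ih ⟩
      ((a * b + a * b) * (a * b + a * b)) * (A * B)
        ≈⟨ S.solve 4 (λ a b A B → ((a S.:* b S.:+ a S.:* b) S.:* (a S.:* b S.:+ a S.:* b)) S.:* (A S.:* B)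
             S.:= ((a S.:* a S.:* B) S.:* (b S.:* b S.:* A) S.:+ (a S.:* a S.:* B) S.:* (b S.:* b S.:* A))
               S.:+ ((a S.:* a S.:* B) S.:* (b S.:* b S.:* A) S.:+ (a S.:* a S.:* B) S.:* (b S.:* b S.:* A))) refl a b A B ⟩
      (P * R + P * R) + (P * R + P * R)
        ≤⟨ +-monoˡ-≤ _ (2xy≤x²+y² P R) ⟩
      (P * P + R * R) + (P * R + P * R)
        ≈⟨ S.solve 2 (λ P R → (P S.:* P S.:+ R S.:* R) S.:+ (P S.:* R S.:+ P S.:* R) S.:= (P S.:+ R) S.:* (P S.:+ R)) refl P R ⟩
      (P + R) * (P + R) ∎)

  ‖‖₂-nonNeg : (v : Vector Carrier n) → 0# ≤ ‖ v ‖₂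
  ‖‖₂-nonNeg v = √-nonNeg _

  ‖‖₂-square : (v : Vector Carrier n) → ‖ v ‖₂ * ‖ v ‖₂ ≈ v ∙ v
  ‖‖₂-square v = √-square (∙-nonNeg v)

  -- Together with `‖‖₂≤⇒∙≤`, this translates norm estimates into estimates of squared norms, with
  -- which the later computations work.
  ‖‖₂-≤ : ∀ {c} (v : Vector Carrier n) → 0# ≤ c → v ∙ v ≤ c * c → ‖ v ‖₂ ≤ c
  ‖‖₂-≤ v 0≤c v²≤c² = square-cancel-≤ 0≤c (≤-trans (≤-reflexive (‖‖₂-square v)) v²≤c²)

  ‖‖₂≤⇒∙≤ : ∀ {c} (v : Vector Carrier n) → ‖ v ‖₂ ≤ c → v ∙ v ≤ c * c
  ‖‖₂≤⇒∙≤ v ‖v‖≤c = ≤-trans (≤-reflexive (sym (‖‖₂-square v))) (square-mono-≤ (‖‖₂-nonNeg v) ‖v‖≤c)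

  maximum-nonNeg : (v : Vector Carrier n) → 0# ≤ maximum v
  maximum-nonNeg {zero}  v = ≤-refl
  maximum-nonNeg {suc n} v = ≤-trans (maximum-nonNeg (v ∘ suc)) (x≤y⊔x _ _)

  maximum-upper : (v : Vector Carrier n) → ∀ i → v i ≤ maximum v
  maximum-upper v zero    = x≤x⊔y _ _
  maximum-upper v (suc i) = ≤-trans (maximum-upper (v ∘ suc) i) (x≤y⊔x _ _)

  maximum-least : ∀ {c} (v : Vector Carrier n) → 0# ≤ c → (∀ i → v i ≤ c) → maximum v ≤ c
  maximum-least {zero}  v 0≤c v≤c = 0≤c
  maximum-least {suc n} v 0≤c v≤c = ⊔-lub (v≤c zero) (maximum-least (v ∘ suc) 0≤c (v≤c ∘ suc))

  ∣∣≤1 : ∀ {x} → x * x ≤ 1# → ∣ x ∣ ≤ 1#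
  ∣∣≤1 {x} x²≤1 = ⊔-lub
    (square-cancel-≤ 0≤1 x²≤1²)
    (square-cancel-≤ 0≤1 (≤-trans (≤-reflexive (-x*-x≈x*x x)) x²≤1²))
    where
    x²≤1² = ≤-trans x²≤1 (≤-reflexive (sym (*-identityˡ 1#)))

  1≤∣∣ : ∀ {x} → x * x ≈ 1# → 1# ≤ ∣ x ∣
  1≤∣∣ {x} x²≈1 with total 0# x
  ... | inj₁ 0≤x = ≤-trans (square-cancel-≤ 0≤x (≤-reflexive (trans (*-identityˡ 1#) (sym x²≈1)))) (x≤x⊔y _ _)
  ... | inj₂ x≤0 = ≤-trans
    (square-cancel-≤ (≤-trans (x≤y⇒0≤y-x x≤0) (≤-reflexive (+-identityˡ (- x))))
      (≤-reflexive (trans (*-identityˡ 1#) (trans (sym x²≈1) (sym (-x*-x≈x*x x))))))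
    (x≤y⊔x _ _)

  column-bound : ∀ {c} (R : Matrix k n) → ‖ R ‖₁→₂ ≤ c → ∀ j → sum (λ r → R r j * R r j) ≤ c * c
  column-bound R ‖R‖≤c j = ‖‖₂≤⇒∙≤ (λ r → R r j) (≤-trans (maximum-upper (λ j → ‖ (λ i → R i j) ‖₂) j) ‖R‖≤c)

  row-bound : (L : Matrix m k) → ∀ i → L i ∙ L i ≤ ‖ L ‖₂→∞ * ‖ L ‖₂→∞
  row-bound L i = ‖‖₂≤⇒∙≤ (L i) (maximum-upper (λ i → ‖ L i ‖₂) i)

  ‖‖₁→₂-nonNeg : (R : Matrix m n) → 0# ≤ ‖ R ‖₁→₂
  ‖‖₁→₂-nonNeg R = maximum-nonNeg (λ j → ‖ (λ i → R i j) ‖₂)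

  ‖‖₂→∞-nonNeg : (L : Matrix m n) → 0# ≤ ‖ L ‖₂→∞
  ‖‖₂→∞-nonNeg L = maximum-nonNeg (λ i → ‖ L i ‖₂)

  δ : Matrix n n
  δ zero    zero    = 1#
  δ zero    (suc _) = 0#
  δ (suc _) zero    = 0#
  δ (suc i) (suc j) = δ i j

  0∙v≈0 : (v : Vector Carrier n) → (λ _ → 0#) ∙ v ≈ 0#
  0∙v≈0 v = trans (sym (*-distribˡ-sum 0# v)) (zeroˡ _)

  δ∙v≈v : ∀ i (v : Vector Carrier n) → δ i ∙ v ≈ v i
  δ∙v≈v zero    v = trans (+-cong (*-identityˡ _) (0∙v≈0 (v ∘ suc))) (+-identityʳ _)
  δ∙v≈v (suc i) v = trans (+-cong (zeroˡ _) (δ∙v≈v i (v ∘ suc))) (+-identityˡ _)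

  δᵢᵢ≈1 : (i : Fin n) → δ i i ≈ 1#
  δᵢᵢ≈1 zero    = refl
  δᵢᵢ≈1 (suc i) = δᵢᵢ≈1 i

  -- The dimension is a successor because the empty identity matrix has norm 0.
  ‖δ‖₂→∞≈1 : ‖ δ {suc n} ‖₂→∞ ≈ 1#
  ‖δ‖₂→∞≈1 {n} = antisym
    (maximum-least _ 0≤1 (λ i → ‖‖₂-≤ (δ i) 0≤1 (≤-reflexive (trans (δ∙δ≈1 i) (sym (*-identityˡ 1#))))))
    (≤-trans
      (square-cancel-≤ (‖‖₂-nonNeg (δ {suc n} zero))
        (≤-reflexive (trans (*-identityˡ 1#) (sym (trans (‖‖₂-square (δ {suc n} zero)) (δ∙δ≈1 zero))))))
      (maximum-upper (λ i → ‖ δ {suc n} i ‖₂) zero))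
    where
    δ∙δ≈1 : (i : Fin (suc n)) → δ i ∙ δ i ≈ 1#
    δ∙δ≈1 i = trans (δ∙v≈v i (δ i)) (δᵢᵢ≈1 i)

  -- ‖ R x ‖₂²
  energy : Matrix k n → Vector Carrier n → Carrier
  energy R x = sum (λ r → (R r ∙ x) * (R r ∙ x))

  energy-nonNeg : (R : Matrix k n) (x : Vector Carrier n) → 0# ≤ energy R x
  energy-nonNeg R x = ∙-nonNeg (λ r → R r ∙ x)

  ᵛ*ᴹ-adjoint : (ℓ : Vector Carrier k) (R : Matrix k n) (x : Vector Carrier n) →
                (ℓ ᵛ*ᴹ R) ∙ x ≈ ℓ ∙ (λ r → R r ∙ x)
  ᵛ*ᴹ-adjoint {k} {n} ℓ R x = begin-equality
    sum (λ j → sum (λ r → ℓ r * R r j) * x j)   ≈⟨ sum-cong-≋ {n} (λ j → trans (*-distribʳ-sum {k} (x j) _) (sum-cong-≋ {k} (λ r → *-assoc _ _ _))) ⟩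
    sum (λ j → sum (λ r → ℓ r * (R r j * x j))) ≈⟨ ∑-comm (λ j r → ℓ r * (R r j * x j)) ⟩
    sum (λ r → sum (λ j → ℓ r * (R r j * x j))) ≈⟨ sum-cong-≋ {k} (λ r → *-distribˡ-sum {n} (ℓ r) _) ⟨
    sum (λ r → ℓ r * (R r ∙ x))                 ∎

  -- `q ∙ x` is the inner product of `ℓ` with `R x`, so Cauchy-Schwarz applies. This ties the two
  -- factors together: a short `ℓ` forces `R x` to be long in each direction `x` that `q` detects.
  energy-bound : ∀ {q} (ℓ : Vector Carrier k) (R : Matrix k n) (x : Vector Carrier n) → ℓ ᵛ*ᴹ R ≈ᵛ q →
                 (q ∙ x) * (q ∙ x) ≤ (ℓ ∙ ℓ) * energy R x
  energy-bound {q = q} ℓ R x ℓR≈q = begin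
    (q ∙ x) * (q ∙ x)                              ≈⟨ *-cong q∙x≈ q∙x≈ ⟩
    (ℓ ∙ (λ r → R r ∙ x)) * (ℓ ∙ (λ r → R r ∙ x))  ≤⟨ cauchy-schwarz ℓ _ ⟩
    (ℓ ∙ ℓ) * energy R x                           ∎
    where
    q∙x≈ : q ∙ x ≈ ℓ ∙ (λ r → R r ∙ x)
    q∙x≈ = trans (sum-cong-≋ (λ j → *-congʳ (sym (ℓR≈q j)))) (ᵛ*ᴹ-adjoint ℓ R x)

-- Weighted orthogonal rows and the value of γ₂.

module Frames (ℝ : CompleteOrderedField) where

  open CompleteOrderedField ℝ hiding (zero)
  open Factorization ℝ
  open OrderedField ℝ
  open Norms ℝ
  open CommutativeMonoidSum +-commutativeMonoid using (sum-cong-≋; ∑-comm)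
  open PosetReasoning (TotalOrder.poset totalOrder)
  open SemiringSum semiring using (*-distribˡ-sum)
  private
    module S = NatSolver commutativeSemiring

    variable
      k m n t M : ℕ

  -- The rows of h are orthogonal, of squared length M, and supported on the M
  -- columns selected by ι; rows weighted by d = 0 are exempt.
  record IsFrame {m n M} (ι : Fin M → Fin n) (d : Vector Carrier m) (h : Matrix m n) : Set where
    field
      bessel  : ∀ x → sum (λ i → (x ∙ h i) * (x ∙ h i)) ≤ fromℕ M * ((x ∘ ι) ∙ (x ∘ ι))
      norm    : ∀ i → d i * (h i ∙ h i) ≈ d i * fromℕ M
      flat    : ∀ i j → (d i * h i j) * (d i * h i j) ≤ d i * d i
      tight   : ∃[ j ] ∀ i → (d i * h i j) * (d i * h i j) ≈ d i * d i

    scaled : Matrix m n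
    scaled i j = d i * h i j

    scaled∙h : ∀ i → scaled i ∙ h i ≈ d i * fromℕ M
    scaled∙h i = trans (trans (sum-cong-≋ {n} (λ j → *-assoc _ _ _)) (sym (*-distribˡ-sum {n} (d i) _))) (norm i)

    -- Interchanging the sums leaves one Bessel inequality for each row of `R`. What remains are the
    -- squared norms of the `M` columns selected by `ι`, each at most `c * c`; the restriction to
    -- these columns makes the bound quadratic in `M`, whatever the number `n` of columns.
    total-energy : ∀ {c} (R : Matrix k n) → ‖ R ‖₁→₂ ≤ c →
                   sum (λ i → energy R (h i)) ≤ fromℕ M * (fromℕ M * (c * c))
    total-energy {k} {c} R ‖R‖≤c = begin
      sum (λ i → sum (λ r → (R r ∙ h i) * (R r ∙ h i)))
        ≈⟨ ∑-comm {m} {k} (λ i r → (R r ∙ h i) * (R r ∙ h i)) ⟩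
      sum (λ r → sum (λ i → (R r ∙ h i) * (R r ∙ h i)))
        ≤⟨ sum-mono-≤ (λ r → bessel (R r)) ⟩
      sum (λ r → fromℕ M * ((R r ∘ ι) ∙ (R r ∘ ι)))
        ≈⟨ *-distribˡ-sum {k} (fromℕ M) _ ⟨
      fromℕ M * sum (λ r → (R r ∘ ι) ∙ (R r ∘ ι))
        ≈⟨ *-congˡ (∑-comm {k} {M} (λ r j → R r (ι j) * R r (ι j))) ⟩
      fromℕ M * sum (λ j → sum (λ r → R r (ι j) * R r (ι j)))
        ≤⟨ *-monoʳ-≤ (fromℕ-nonNeg M) (sum-mono-≤ (λ j → column-bound R ‖R‖≤c (ι j))) ⟩
      fromℕ M * sum {M} (λ _ → c * c)
        ≈⟨ *-congˡ (sum-const M (c * c)) ⟩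
      fromℕ M * (fromℕ M * (c * c)) ∎

  open IsFrame

  -- All conditions concern single rows except `bessel`, whose left side only loses nonnegative
  -- terms. This serves both for the initial segments of `Q` and for discarding the padding rows.
  restrict : ∀ {ι : Fin M → Fin n} {d : Vector Carrier m} {h : Matrix m n} .(t≤m : t ℕ.≤ m) → IsFrame ι d h →
             IsFrame ι (λ i → d (inject≤ {t} i t≤m)) (λ i → h (inject≤ {t} i t≤m))
  restrict t≤m F = record
    { bessel = λ x → ≤-trans (sum-inject≤-≤ t≤m (λ i → square-nonNeg (x ∙ _))) (bessel F x)
    ; norm   = λ i → norm F (inject≤ i t≤m)
    ; flat   = λ i → flat F (inject≤ i t≤m)
    ; tight  = proj₁ (tight F) , λ i → proj₂ (tight F) (inject≤ i t≤m)
    }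

  -- Summing `energy-bound` over the pairs `L i`, `h i` compares `μ² (d ∙ d)` with the total energy
  -- of `R`. The common factor `μ²` cancels, `μ` being nonzero because the order is a successor.
  γ₂-lower : ∀ {γ} {ι : Fin (suc M) → Fin n} {d : Vector Carrier m} {h : Matrix m n} (F : IsFrame ι d h)
             (L : Matrix m k) (R : Matrix k n) → L *ᴹ R ≈ᴹ scaled F → d ∙ d ≈ γ * γ → γ ≤ ‖ L ‖₂→∞ * ‖ R ‖₁→₂
  γ₂-lower {M} {n} {m} {k} {γ} {ι} {d} {h} F L R LR≈Q d²≈γ² =
    square-cancel-≤ (*-nonNeg (‖‖₂→∞-nonNeg L) (‖‖₁→₂-nonNeg R))
      (*-cancelˡ-≤ (fromℕ-nonNeg (suc M)) (fromℕ-suc≉0 M) (*-cancelˡ-≤ (fromℕ-nonNeg (suc M)) (fromℕ-suc≉0 M) (begin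
        μ * (μ * (γ * γ))
          ≈⟨ *-congˡ (*-congˡ d²≈γ²) ⟨
        μ * (μ * (d ∙ d))
          ≈⟨ *-assoc μ μ _ ⟨
        (μ * μ) * (d ∙ d)
          ≈⟨ *-distribˡ-sum {m} (μ * μ) _ ⟩
        sum (λ i → (μ * μ) * (d i * d i))
          ≈⟨ sum-cong-≋ {m} (λ i → trans (μ²d² (d i)) (sym (*-cong (scaled∙h F i) (scaled∙h F i)))) ⟩
        sum (λ i → (scaled F i ∙ h i) * (scaled F i ∙ h i))
          ≤⟨ sum-mono-≤ (λ i → ≤-trans (energy-bound (L i) R (h i) (LR≈Q i))
               (*-monoˡ-≤ (energy-nonNeg R (h i)) (row-bound L i))) ⟩
        sum (λ i → (a * a) * energy R (h i))
          ≈⟨ *-distribˡ-sum {m} (a * a) _ ⟨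
        (a * a) * sum (λ i → energy R (h i))
          ≤⟨ *-monoʳ-≤ (square-nonNeg a) (total-energy F R ≤-refl) ⟩
        (a * a) * (μ * (μ * (b * b)))
          ≈⟨ S.solve 3 (λ a b μ → (a S.:* a) S.:* (μ S.:* (μ S.:* (b S.:* b)))
               S.:= μ S.:* (μ S.:* ((a S.:* b) S.:* (a S.:* b)))) refl a b μ ⟩
        μ * (μ * ((a * b) * (a * b))) ∎)))
    where
    μ = fromℕ (suc M)
    a = ‖ L ‖₂→∞
    b = ‖ R ‖₁→₂
    μ²d² : ∀ x → (μ * μ) * (x * x) ≈ (x * μ) * (x * μ)
    μ²d² x = S.solve 2 (λ μ x → (μ S.:* μ) S.:* (x S.:* x) S.:= (x S.:* μ) S.:* (x S.:* μ)) refl μ x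

  -- The trivial factorization, identity times `Q`, attains the lower bound: by `flat` no column of
  -- `Q` is longer than `d`, and the column given by `tight` is exactly as long.
  γ₂-scaled : ∀ {γ} {ι : Fin (suc M) → Fin n} {d : Vector Carrier (suc m)} {h : Matrix (suc m) n} →
              (F : IsFrame ι d h) → 0# ≤ γ → d ∙ d ≈ γ * γ → Isγ₂ (scaled F) γ
  γ₂-scaled {M} {n} {m} {γ} {ι} {d} {h} F 0≤γ d²≈γ² =
    (suc m , δ , Q , (λ i j → δ∙v≈v i (λ r → Q r j)) , (begin-equality
      γ                             ≈⟨ *-identityˡ γ ⟨
      1# * γ                        ≈⟨ *-cong (‖δ‖₂→∞≈1 {m}) ‖Q‖≈γ ⟨
      ‖ δ {suc m} ‖₂→∞ * ‖ Q ‖₁→₂ ∎))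
    , λ k L R LR≈Q → γ₂-lower F L R LR≈Q d²≈γ²
    where
    Q = scaled F

    ‖Q‖≈γ : ‖ Q ‖₁→₂ ≈ γ
    ‖Q‖≈γ = antisym
      (maximum-least _ 0≤γ (λ j → ‖‖₂-≤ (λ i → Q i j) 0≤γ
        (≤-trans (sum-mono-≤ (λ i → flat F i j)) (≤-reflexive d²≈γ²))))
      (begin
        γ                     ≈⟨ square-cancel-≈ (‖‖₂-nonNeg (λ i → Q i j)) 0≤γ
                                   (trans (‖‖₂-square (λ i → Q i j)) (trans (sum-cong-≋ {suc m} j-tight) d²≈γ²)) ⟨
        ‖ (λ i → Q i j) ‖₂    ≤⟨ maximum-upper (λ j → ‖ (λ i → Q i j) ‖₂) j ⟩
        ‖ Q ‖₁→₂              ∎)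
      where
      j = proj₁ (tight F)
      j-tight = proj₂ (tight F)

-- Sylvester-Hadamard matrices.

-- 2 ^ k - 1, by a recursion under which suc (mersenne (suc k)) reduces to a sum.
mersenne : ℕ → ℕ
mersenne zero    = 0
mersenne (suc k) = mersenne k ℕ.+ suc (mersenne k)

module Hadamard (ℝ : CompleteOrderedField) where

  open CompleteOrderedField ℝ hiding (zero)
  open Factorization ℝ
  open OrderedField ℝ
  open Norms ℝ
  open CommutativeMonoidSum +-commutativeMonoid using (sum-cong-≋; ∑-distrib-+)
  open PosetReasoning (TotalOrder.poset totalOrder)
  private
    module S = NatSolver commutativeSemiring

  -- Sylvester's construction, of order 2 ^ k.
  H : ∀ k → Matrix (suc (mersenne k)) (suc (mersenne k))
  H zero    = λ _ _ → 1#
  H (suc k) = (λ i → H k i ++ H k i) ++ (λ i → H k i ++ (λ j → - H k i j))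

  -- The entries are 1 or -1; in the squared form the sign change of the last block disappears.
  H-square : ∀ k i j → H k i j * H k i j ≈ 1#
  H-square zero    i j = *-identityˡ 1#
  H-square (suc k) = ++-elim (λ u → ∀ j → u j * u j ≈ 1#)
    {u = λ i → H k i ++ H k i} {λ i → H k i ++ (λ j → - H k i j)}
    (λ i → ++-elim (λ x → x * x ≈ 1#) {u = H k i} {H k i} (H-square k i) (H-square k i))
    (λ i → ++-elim (λ x → x * x ≈ 1#) {u = H k i} {λ j → - H k i j} (H-square k i) (λ j → trans (-x*-x≈x*x _) (H-square k i j)))

  -- If `a` and `b` are the transforms of the two halves of `x`, the transform of `x` consists of
  -- `a + b` and `a - b`. The parallelogram law doubles the sum of squares, and the order doubles
  -- with it.
  H-parseval : ∀ k x → sum (λ i → (x ∙ H k i) * (x ∙ H k i)) ≈ fromℕ (suc (mersenne k)) * (x ∙ x)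
  H-parseval zero    x = S.solve 1 (λ a → ((a S.:* S.con 1 S.:+ S.con 0) S.:* (a S.:* S.con 1 S.:+ S.con 0)) S.:+ S.con 0
    S.:= (S.con 1 S.:+ S.con 0) S.:* (a S.:* a S.:+ S.con 0)) refl (x zero)
  H-parseval (suc k) x = begin-equality
    sum (λ i → (x ∙ H (suc k) i) * (x ∙ H (suc k) i))
      ≈⟨ sum-++ (λ u → (x ∙ u) * (x ∙ u)) (λ i → H k i ++ H k i) (λ i → H k i ++ (λ j → - H k i j)) ⟩
    sum (λ i → (x ∙ (H k i ++ H k i)) * (x ∙ (H k i ++ H k i)))
      + sum (λ i → (x ∙ (H k i ++ (λ j → - H k i j))) * (x ∙ (H k i ++ (λ j → - H k i j))))
      ≈⟨ +-cong
           (sum-cong-≋ {N} (λ i → *-cong (∙-++ x (H k i) (H k i)) (∙-++ x (H k i) (H k i))))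
           (sum-cong-≋ {N} (λ i → *-cong (difference i) (difference i))) ⟩
    sum (λ i → (a i + b i) * (a i + b i)) + sum (λ i → (a i - b i) * (a i - b i))
      ≈⟨ ∑-distrib-+ {N} (λ i → (a i + b i) * (a i + b i)) (λ i → (a i - b i) * (a i - b i)) ⟨
    sum (λ i → (a i + b i) * (a i + b i) + (a i - b i) * (a i - b i))
      ≈⟨ sum-cong-≋ {N} (λ i → parallelogram (a i) (b i)) ⟩
    sum (λ i → (a i * a i + b i * b i) + (a i * a i + b i * b i))
      ≈⟨ trans (∑-distrib-+ {N} (λ i → a² i + b² i) (λ i → a² i + b² i))
           (+-cong (∑-distrib-+ {N} a² b²) (∑-distrib-+ {N} a² b²)) ⟩
    (sum (λ i → a i * a i) + sum (λ i → b i * b i)) + (sum (λ i → a i * a i) + sum (λ i → b i * b i))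
      ≈⟨ +-cong (+-cong (H-parseval k xˡ) (H-parseval k xʳ)) (+-cong (H-parseval k xˡ) (H-parseval k xʳ)) ⟩
    (μ * (xˡ ∙ xˡ) + μ * (xʳ ∙ xʳ)) + (μ * (xˡ ∙ xˡ) + μ * (xʳ ∙ xʳ))
      ≈⟨ S.solve 3 (λ μ A B → (μ S.:* A S.:+ μ S.:* B) S.:+ (μ S.:* A S.:+ μ S.:* B)
           S.:= (μ S.:+ μ) S.:* (A S.:+ B)) refl μ (xˡ ∙ xˡ) (xʳ ∙ xʳ) ⟩
    (μ + μ) * (xˡ ∙ xˡ + xʳ ∙ xʳ)
      ≈⟨ *-cong (fromℕ-+ N N) (sum-split N {N} (λ i → x i * x i)) ⟨
    fromℕ (N ℕ.+ N) * (x ∙ x) ∎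
    where
    N = suc (mersenne k)
    μ = fromℕ N
    xˡ xʳ : Vector Carrier N
    xˡ i = x (i ↑ˡ N)
    xʳ i = x (N ↑ʳ i)
    a b a² b² : Vector Carrier N
    a i = xˡ ∙ H k i
    b i = xʳ ∙ H k i
    a² i = a i * a i
    b² i = b i * b i
    difference : ∀ i → x ∙ (H k i ++ (λ j → - H k i j)) ≈ a i - b i
    difference i = trans (∙-++ x (H k i) (λ j → - H k i j)) (+-congˡ (∙-negʳ xʳ (H k i)))

-- The hard matrix and γ₂ of its initial segments.

module Construction (ℝ : CompleteOrderedField) (k n : ℕ) (p≤n : mersenne k ℕ.≤ n) where

  open CompleteOrderedField ℝ hiding (zero)
  open Factorization ℝ
  open OrderedField ℝ
  open Norms ℝ
  open Frames ℝ
  open Hadamard ℝ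
  open OnlineAlgorithm using (value)
  open CommutativeMonoidSum +-commutativeMonoid using (sum-cong-≋)
  open PosetReasoning (TotalOrder.poset totalOrder)
  open SemiringSum semiring using (*-distribˡ-sum)
  private
    module S = NatSolver commutativeSemiring

  p M N : ℕ
  p = mersenne k
  M = suc p
  N = suc n

  M≤N : M ℕ.≤ N
  M≤N = ℕ.s≤s p≤n

  2# 3# μ : Carrier
  2# = fromℕ 2
  3# = fromℕ 3
  μ = fromℕ M

  -- Chosen so that the squares of the first s + 1 weights sum to 4 ^ s.
  weight : ℕ → Carrier
  weight zero    = 1#
  weight (suc s) = √ 3# * 2# ^ s

  weight-suc² : ∀ s → weight (suc s) * weight (suc s) ≈ 3# * (2# ^ s * 2# ^ s)
  weight-suc² s = trans
    (S.solve 2 (λ a b → (a S.:* b) S.:* (a S.:* b) S.:= (a S.:* a) S.:* (b S.:* b)) refl (√ 3#) (2# ^ s))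
    (*-congʳ (√-square (fromℕ-nonNeg 3)))

  weights : ∀ {s} → Vector Carrier s
  weights i = weight (toℕ i)

  -- The geometric sum `1 + 3 (1 + 4 + ... + 4^(s-1)) = 4^s`, with the right side left as the square
  -- of `γ = 2^s`.
  weights∙weights : ∀ s → weights {suc s} ∙ weights ≈ 2# ^ s * 2# ^ s
  weights∙weights s = trans (+-cong (*-identityˡ 1#) (sum-cong-≋ {s} (λ i → weight-suc² (toℕ i)))) (geometric s)
    where
    geometric : ∀ s → 1# + sum {s} (λ i → 3# * (2# ^ toℕ i * 2# ^ toℕ i)) ≈ 2# ^ s * 2# ^ s
    geometric zero    = trans (+-identityʳ 1#) (sym (*-identityˡ 1#))
    -- The first term is split off and 4 is factored out of the others: `1 + (3 + 4 T) = 4 (1 + T)`.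
    geometric (suc s) = begin-equality
      1# + (3# * (1# * 1#) + sum {s} (λ i → 3# * ((2# * 2# ^ toℕ i) * (2# * 2# ^ toℕ i))))
        ≈⟨ +-congˡ (+-congˡ (trans (sum-cong-≋ {s} (λ i →
             S.solve 3 (λ a b c → a S.:* ((b S.:* c) S.:* (b S.:* c)) S.:= (b S.:* b) S.:* (a S.:* (c S.:* c))) refl 3# 2# (2# ^ toℕ i)))
             (sym (*-distribˡ-sum {s} (2# * 2#) _)))) ⟩
      1# + (3# * (1# * 1#) + (2# * 2#) * T)
        ≈⟨ S.solve 1 (λ T → S.con 1 S.:+ (three S.:* (S.con 1 S.:* S.con 1) S.:+ (two S.:* two) S.:* T)
             S.:= (two S.:* two) S.:* (S.con 1 S.:+ T)) refl T ⟩
      (2# * 2#) * (1# + T)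
        ≈⟨ *-congˡ (geometric s) ⟩
      (2# * 2#) * (2# ^ s * 2# ^ s)
        ≈⟨ S.solve 2 (λ a b → (a S.:* a) S.:* (b S.:* b) S.:= (a S.:* b) S.:* (a S.:* b)) refl 2# (2# ^ s) ⟩
      (2# * 2# ^ s) * (2# * 2# ^ s) ∎
      where
      T = sum {s} (λ i → 3# * (2# ^ toℕ i * 2# ^ toℕ i))
      -- Spelled out so as to evaluate to the unfolded forms of `fromℕ 2` and `fromℕ 3`.
      two three : S.Polynomial 1
      two = S.con 1 S.:+ (S.con 1 S.:+ S.con 0)
      three = S.con 1 S.:+ two

  -- An equality for every row but the first, where it reads `3 ≤ 4`.
  3*4^s≤4*weight² : ∀ s → 3# * (2# ^ s * 2# ^ s) ≤ (2# * 2#) * (weight s * weight s)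
  3*4^s≤4*weight² zero    = *-monoˡ-≤ (square-nonNeg 1#)
    (≤-trans (fromℕ-mono-≤ (ℕ.n≤1+n 3)) (≤-reflexive (fromℕ-* 2 2)))
  3*4^s≤4*weight² (suc s) = ≤-reflexive (trans
    (S.solve 3 (λ a b c → a S.:* ((b S.:* c) S.:* (b S.:* c)) S.:= (b S.:* b) S.:* (a S.:* (c S.:* c))) refl 3# 2# (2# ^ s))
    (*-congˡ (sym (weight-suc² s))))

  paddedH : Matrix M N
  paddedH i = pad 0# (H k i)

  weightedRows : Vector (Carrier × Vector Carrier N) M
  weightedRows i = weights i , paddedH i

  -- Weights and rows are padded as pairs, so that a single use of `pad-elim` or `sum-pad` treats
  -- `d` and `h` at the same index.
  rows : Vector (Carrier × Vector Carrier N) N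
  rows = pad (0# , λ _ → 0#) weightedRows

  d : Vector Carrier N
  d i = proj₁ (rows i)

  h : Matrix N N
  h i = proj₂ (rows i)

  ι : Fin M → Fin N
  ι i = inject≤ i M≤N

  frame : IsFrame ι d h
  frame = record
    -- Padding rows contribute 0, and the others see only the first `M` coordinates of `x`, where
    -- Parseval holds for `H k`.
    { bessel = λ x → ≤-reflexive (begin-equality
        sum (λ i → (x ∙ h i) * (x ∙ h i))
          ≈⟨ sum-pad (λ _ r → (x ∙ proj₂ r) * (x ∙ proj₂ r)) (λ _ → trans (*-congˡ (x∙0≈0 x)) (zeroʳ _)) weightedRows M≤N ⟩
        sum (λ i → (x ∙ paddedH i) * (x ∙ paddedH i))
          ≈⟨ sum-cong-≋ {M} (λ i → *-cong (x∙pad x (H k i)) (x∙pad x (H k i))) ⟩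
        sum (λ i → ((x ∘ ι) ∙ H k i) * ((x ∘ ι) ∙ H k i))
          ≈⟨ H-parseval k (x ∘ ι) ⟩
        μ * ((x ∘ ι) ∙ (x ∘ ι)) ∎)
    ; norm = pad-elim (λ r → proj₁ r * (proj₂ r ∙ proj₂ r) ≈ proj₁ r * μ)
        (trans (zeroˡ _) (sym (zeroˡ _)))
        (λ i → *-congˡ (begin-equality
          paddedH i ∙ paddedH i   ≈⟨ sum-pad {n = N} (λ _ a → a * a) (λ _ → zeroˡ 0#) (H k i) M≤N ⟩
          H k i ∙ H k i                     ≈⟨ sum-cong-≋ {M} (H-square k i) ⟩
          sum {M} (λ _ → 1#)                ≈⟨ sum-const M 1# ⟩
          μ * 1#                            ≈⟨ *-identityʳ μ ⟩
          μ                                 ∎))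
    ; flat = pad-elim (λ r → ∀ j → (proj₁ r * proj₂ r j) * (proj₁ r * proj₂ r j) ≤ proj₁ r * proj₁ r)
        (λ j → ≤-reflexive (*-cong (zeroˡ 0#) (zeroˡ 0#)))
        (λ i j → begin
          (weights i * paddedH i j) * (weights i * paddedH i j)   ≈⟨ interchange (weights i) _ ⟩
          (weights i * weights i) * (paddedH i j * paddedH i j)   ≤⟨ *-monoʳ-≤ (square-nonNeg _)
            (pad-elim (λ a → a * a ≤ 1#) (≤-trans (≤-reflexive (zeroˡ 0#)) 0≤1) (λ j → ≤-reflexive (H-square k i j)) j) ⟩
          (weights i * weights i) * 1#                                      ≈⟨ *-identityʳ _ ⟩
          weights i * weights i                                             ∎)
    -- Since `M ≥ 1`, the first column meets the Hadamard block, so its entries are 1 or -1 in all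
    -- rows of nonzero weight.
    ; tight = zero , pad-elim (λ r → (proj₁ r * proj₂ r zero) * (proj₁ r * proj₂ r zero) ≈ proj₁ r * proj₁ r)
        (*-cong (zeroˡ 0#) (zeroˡ 0#))
        (λ i → trans (interchange (weights i) _) (trans (*-congˡ (H-square k i zero)) (*-identityʳ _)))
    }
    where
    interchange : ∀ a b → (a * b) * (a * b) ≈ (a * a) * (b * b)
    interchange a b = S.solve 2 (λ a b → (a S.:* b) S.:* (a S.:* b) S.:= (a S.:* a) S.:* (b S.:* b)) refl a b

    x∙0≈0 : (x : Vector Carrier N) → x ∙ (λ _ → 0#) ≈ 0#
    x∙0≈0 x = trans (sum-cong-≋ {N} (λ j → zeroʳ (x j))) (trans (sum-const N 0#) (zeroʳ _))

    x∙pad : (x : Vector Carrier N) (v : Vector Carrier M) → x ∙ pad 0# v ≈ (x ∘ ι) ∙ v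
    x∙pad x v = sum-pad (λ j a → x j * a) (λ j → zeroʳ (x j)) v M≤N

  Q : Matrix N N
  Q = IsFrame.scaled frame

  ‖Q₀‖∞≈1 : ‖ Q zero ‖∞ ≈ 1#
  ‖Q₀‖∞≈1 = antisym
    (maximum-least _ 0≤1 (λ j → ∣∣≤1 (≤-trans (IsFrame.flat frame zero j) (≤-reflexive (*-identityˡ 1#)))))
    (≤-trans (1≤∣∣ (trans (proj₂ (IsFrame.tight frame) zero) (*-identityˡ 1#))) (maximum-upper (λ j → ∣ Q zero j ∣) zero))

  2^-nonNeg : ∀ s → 0# ≤ 2# ^ s
  2^-nonNeg s = ≤-trans 0≤1 (1≤2^n s)

  γ₂-Q : Isγ₂ Q (2# ^ p)
  γ₂-Q = γ₂-scaled frame (2^-nonNeg p) (trans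
    (sum-pad (λ _ r → proj₁ r * proj₁ r) (λ _ → zeroˡ 0#) weightedRows M≤N)
    (weights∙weights p))

  d-inject≤ : ∀ {t} .(t≤N : t ℕ.≤ N) .(t≤M : t ℕ.≤ M) (i : Fin t) → d (inject≤ i t≤N) ≡ weights i
  d-inject≤ t≤N t≤M i = ≡.trans
    (≡.cong proj₁ (pad-inject≤ weightedRows t≤N t≤M i))
    (≡.cong weight (toℕ-inject≤ i t≤M))

  -- As `s < M`, none of the first `s + 1` rows is padding, and the squares of their weights sum to
  -- `4^s`.
  γ₂-firstRows : ∀ s (s<M : s ℕ.< M) (s<N : s ℕ.< N) → Isγ₂ (firstRows Q (suc s) s<N) (2# ^ s)
  γ₂-firstRows s s<M s<N = γ₂-scaled (restrict s<N frame) (2^-nonNeg s) (trans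
    (sum-cong-≋ {suc s} (λ i → *-cong (reflexive (d-inject≤ s<N s<M i)) (reflexive (d-inject≤ s<N s<M i))))
    (weights∙weights s))

  -- The lower bound for online algorithms.

  module _ (A : OnlineAlgorithm N) (factorizes : Factorizes A Q) where

    open OnlineAlgorithm A using (R; new; ℓ)

    hist : (t : ℕ) → .(t ℕ.≤ N) → History N
    hist = history Q

    -- Appended rows only add squares. Hence the right factor of every step up to `M` can be
    -- replaced by that of step `M`, and one energy budget serves for all these steps.
    energy-hist-mono : ∀ x {t u} → t ℕ.≤′ u → .(t≤N : t ℕ.≤ N) .(u≤N : u ℕ.≤ N) →
                       energy (R (hist t t≤N)) x ≤ energy (R (hist u u≤N)) x
    energy-hist-mono x ℕ.≤′-refl _ _ = ≤-refl
    energy-hist-mono x {t} {suc u} (ℕ.≤′-step t≤u) t≤N u<N = begin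
      energy (R (hist t t≤N)) x
        ≤⟨ energy-hist-mono x t≤u t≤N (ℕ.<⇒≤ u<N) ⟩
      energy (R (hist u (ℕ.<⇒≤ u<N))) x
        ≤⟨ x≤x+y (energy-nonNeg (new q (hist u (ℕ.<⇒≤ u<N))) x) ⟩
      energy (R (hist u (ℕ.<⇒≤ u<N))) x + energy (new q (hist u (ℕ.<⇒≤ u<N))) x
        ≈⟨ sum-++ (λ r → (r ∙ x) * (r ∙ x)) (R (hist u (ℕ.<⇒≤ u<N))) (new q (hist u (ℕ.<⇒≤ u<N))) ⟨
      energy (R (hist (suc u) u<N)) x ∎
      where
      q = Q (fromℕ< u<N)

    -- Half of the binary logarithm of γ₂(Q), which is `p`.
    c : Carrier
    c = ½ * fromℕ p

    0≤c : 0# ≤ c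
    0≤c = *-nonNeg (⁻¹-nonNeg (fromℕ-nonNeg 2) (fromℕ-suc≉0 1)) (fromℕ-nonNeg p)

    4c≈2p : (2# * 2#) * c ≈ fromℕ (p ℕ.+ p)
    4c≈2p = begin-equality
      (2# * 2#) * (½ * fromℕ p)   ≈⟨ S.solve 3 (λ a b c → (a S.:* a) S.:* (b S.:* c) S.:= (a S.:* b) S.:* (a S.:* c)) refl 2# ½ (fromℕ p) ⟩
      (2# * ½) * (2# * fromℕ p)   ≈⟨ *-cong (⁻¹-inverseʳ 2# (fromℕ-suc≉0 1)) (S.solve 1 (λ a → (S.con 1 S.:+ (S.con 1 S.:+ S.con 0)) S.:* a S.:= a S.:+ a) refl (fromℕ p)) ⟩
      1# * (fromℕ p + fromℕ p)    ≈⟨ *-identityˡ _ ⟩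
      fromℕ p + fromℕ p           ≈⟨ fromℕ-+ p p ⟨
      fromℕ (p ℕ.+ p)             ∎

    s<N : (i : Fin M) → toℕ i ℕ.< N
    s<N i = ℕ.≤-trans (toℕ<n i) M≤N

    -- Step `toℕ i + 1` is a witness for the theorem: γ₂ of the first `toℕ i + 1` rows is
    -- `2 ^ toℕ i`. The algorithm's value is thus bounded from below here.
    Competitive : Fin M → Set
    Competitive i = √ c * 2# ^ toℕ i ≤ value A (hist (suc (toℕ i)) (s<N i))

    final-energy : Fin M → Carrier
    final-energy i = energy (R (hist M M≤N)) (h (ι i))

    -- Without a witness at step `s + 1`, `‖ℓ‖²` is at most `c 4^s`, while `q ∙ h = w μ` with
    -- `4 w² ≥ 3 * 4^s`. In `energy-bound` the factor `4^s` cancels. The result is stated without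
    -- division by `p + p`, which can be 0.
    energy-lower : ∀ i → ¬ Competitive i → 3# * (μ * μ) ≤ fromℕ (p ℕ.+ p) * final-energy i
    energy-lower i ¬competitive = *-cancelˡ-≤ (square-nonNeg G) G²≉0 (begin
      (G * G) * (3# * (μ * μ))
        ≈⟨ S.solve 3 (λ a b c → (a S.:* a) S.:* (b S.:* (c S.:* c)) S.:= (b S.:* (a S.:* a)) S.:* (c S.:* c)) refl G 3# μ ⟩
      (3# * (G * G)) * (μ * μ)
        ≤⟨ *-monoˡ-≤ (square-nonNeg μ) (3*4^s≤4*weight² s) ⟩
      ((2# * 2#) * (w * w)) * (μ * μ)
        ≈⟨ S.solve 3 (λ a b c → (a S.:* (b S.:* b)) S.:* (c S.:* c) S.:= a S.:* ((b S.:* c) S.:* (b S.:* c))) refl (2# * 2#) w μ ⟩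
      (2# * 2#) * ((w * μ) * (w * μ))
        ≤⟨ *-monoʳ-≤ (square-nonNeg 2#) row ⟩
      (2# * 2#) * ((c * (G * G)) * final-energy i)
        ≈⟨ S.solve 4 (λ a b c e → a S.:* ((b S.:* c) S.:* e) S.:= c S.:* ((a S.:* b) S.:* e)) refl (2# * 2#) c (G * G) (final-energy i) ⟩
      (G * G) * (((2# * 2#) * c) * final-energy i)
        ≈⟨ *-congˡ (*-congʳ 4c≈2p) ⟩
      (G * G) * (fromℕ (p ℕ.+ p) * final-energy i) ∎)
      where
      s = toℕ i
      G = 2# ^ s
      w = weight s
      j = fromℕ< (s<N i)
      q = Q j
      past = hist s (ℕ.<⇒≤ (s<N i))

      -- `history` locates the row by `fromℕ<`, the frame by `inject≤`.
      j≡ιi : j ≡ ι i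
      j≡ιi = toℕ-injective (≡.trans (toℕ-fromℕ< (s<N i)) (≡.sym (toℕ-inject≤ i M≤N)))

      G²≉0 : ¬ (G * G ≈ 0#)
      G²≉0 = 1≤x⇒x≉0 (≤-trans (≤-reflexive (sym (*-identityˡ 1#))) (square-mono-≤ 0≤1 (1≤2^n s)))

      ℓ∙ℓ≤ : ℓ q past ∙ ℓ q past ≤ c * (G * G)
      -- The value after step `s + 1` is a maximum that includes the norm of this `ℓ`.
      ℓ∙ℓ≤ = ≤-trans (‖‖₂≤⇒∙≤ (ℓ q past) (≤-trans (x≤y⊔x _ _) (≰⇒≥ ¬competitive)))
        (≤-reflexive (trans (S.solve 2 (λ a b → (a S.:* b) S.:* (a S.:* b) S.:= (a S.:* a) S.:* (b S.:* b)) refl (√ c) G)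
          (*-congʳ (√-square 0≤c))))

      row : (w * μ) * (w * μ) ≤ (c * (G * G)) * final-energy i
      row = begin
        (w * μ) * (w * μ)                                   ≈⟨ *-cong q∙h q∙h ⟨
        (q ∙ h j) * (q ∙ h j)                               ≤⟨ energy-bound (ℓ q past) _ (h j) (proj₁ (factorizes s (s<N i))) ⟩
        (ℓ q past ∙ ℓ q past) * energy (R (q ∷ past)) (h j) ≤⟨ *-mono-≤ (*-nonNeg 0≤c (square-nonNeg G)) (energy-nonNeg (R (q ∷ past)) (h j)) ℓ∙ℓ≤
          (≤-trans (energy-hist-mono (h j) (ℕ.≤⇒≤′ (toℕ<n i)) (s<N i) M≤N)
            (≤-reflexive (reflexive (≡.cong (λ j → energy (R (hist M M≤N)) (h j)) j≡ιi)))) ⟩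
        (c * (G * G)) * final-energy i                      ∎
        where
        q∙h : q ∙ h j ≈ w * μ
        q∙h = trans (IsFrame.scaled∙h frame j)
          (*-congʳ (reflexive (≡.trans (≡.cong d j≡ιi) (d-inject≤ M≤N ℕ.≤-refl i))))

    -- If all `M` steps failed, adding up `energy-lower` would give `3 μ³ ≤ 2 p μ²`, hence
    -- `3 M ≤ 2 p`, contrary to `p = M - 1`.
    competitive : ∃ Competitive
    -- The order is decidable and there are `M` candidates, so refuting the absence of a witness
    -- produces one.
    competitive = decidable-stable
      (any? (λ i → (√ c * 2# ^ toℕ i) ≤? value A (hist (suc (toℕ i)) (s<N i))))
      (λ none → contradiction
        (fromℕ-cancel-≤ {3 ℕ.* M} {p ℕ.+ p} (≤-trans (≤-reflexive (fromℕ-* 3 M)) (3μ≤2p (λ i found → none (i , found)))))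
        (ℕ.<⇒≱ (ℕ.+-mono-<-≤ (ℕ.n<1+n p) (ℕ.≤-trans (ℕ.n≤1+n p) (ℕ.m≤m+n M _)))))
      where
      P = fromℕ (p ℕ.+ p)
      cancel-μ : ∀ {x y} → μ * x ≤ μ * y → x ≤ y
      cancel-μ = *-cancelˡ-≤ (fromℕ-nonNeg M) (fromℕ-suc≉0 p)

      3μ≤2p : (∀ i → ¬ Competitive i) → 3# * μ ≤ P
      3μ≤2p none = cancel-μ (cancel-μ (begin
        μ * (μ * (3# * μ))
          ≈⟨ S.solve 2 (λ μ a → μ S.:* (μ S.:* (a S.:* μ)) S.:= μ S.:* (a S.:* (μ S.:* μ))) refl μ 3# ⟩
        μ * (3# * (μ * μ))
          ≈⟨ sum-const M _ ⟨
        sum {M} (λ _ → 3# * (μ * μ))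
          ≤⟨ sum-mono-≤ {M} (λ i → energy-lower i (none i)) ⟩
        sum (λ i → P * final-energy i)
          ≈⟨ *-distribˡ-sum {M} P final-energy ⟨
        P * sum final-energy
          -- Steps count from 0: `M≤N` is also `p < N`, and the clause of `factorizes` at `p` bounds
          -- the norm of the right factor after `M` rows by 1.
          ≤⟨ *-monoʳ-≤ (fromℕ-nonNeg (p ℕ.+ p))
               (IsFrame.total-energy (restrict M≤N frame) (R (hist M M≤N)) (proj₂ (factorizes p M≤N))) ⟩
        P * (μ * (μ * (1# * 1#)))
          ≈⟨ S.solve 2 (λ μ P → P S.:* (μ S.:* (μ S.:* (S.con 1 S.:* S.con 1))) S.:= μ S.:* (μ S.:* P)) refl μ P ⟩
        μ * (μ * P) ∎))

-- Choice of the order and assembly of the theorem.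

-- With `M = mersenne k + 1` and `N = n + 1` this says `M ≤ N < 2 M`. The exponent stays the same
-- until `n` reaches `2 p`; then `n + 1 = 2 p + 1` is the next Mersenne number.
scale : ∀ n → ∃[ k ] mersenne k ℕ.≤ n × n ℕ.≤ mersenne k ℕ.+ mersenne k
scale zero = 0 , ℕ.z≤n , ℕ.z≤n
scale (suc n) with scale n
... | k , p≤n , n≤2p with ℕ.m≤n⇒m<n∨m≡n n≤2p
...   | inj₁ n<2p = k , ℕ.≤-trans p≤n (ℕ.n≤1+n n) , n<2p
...   | inj₂ n≡2p = suc k , ℕ.≤-reflexive (≡.sym 1+n≡p′) , ℕ.≤-trans (ℕ.≤-reflexive 1+n≡p′) (ℕ.m≤m+n _ _)
  where
  1+n≡p′ : suc n ≡ mersenne (suc k)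
  1+n≡p′ = ≡.trans (≡.cong suc n≡2p) (≡.sym (ℕ.+-suc (mersenne k) (mersenne k)))

theorem5p1 : (ℝ : CompleteOrderedField) →
    let open CompleteOrderedField ℝ hiding (zero)
        open Factorization ℝ
        open OnlineAlgorithm using (value)
    in
    -- N = suc n; log₂γ₂ n = log₂ (γ₂(Q n))
    Σ[ Q ∈ (∀ n → Matrix (suc n) (suc n)) ]
    Σ[ γ₂ ∈ (ℕ → Carrier) ]
    Σ[ log₂γ₂ ∈ (ℕ → Carrier) ]
      (∀ n → Isγ₂ (Q n) (γ₂ n) × IsLog₂ (γ₂ n) (log₂γ₂ n)) ×
      (∀ n → ‖ Q n zero ‖∞ ≈ 1#) ×
      IsΘ log₂γ₂ (λ n → fromℕ (suc n)) ×
      (∀ n (A : OnlineAlgorithm (suc n)) → Factorizes A (Q n) →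
        Σ[ t ∈ ℕ ] Σ[ 1≤t ∈ 1 ℕ.≤ t ] Σ[ t≤N ∈ t ℕ.≤ suc n ] Σ[ γ₂ₜ ∈ Carrier ]
          Isγ₂ (firstRows (Q n) t t≤N) γ₂ₜ ×
          √ (½ * log₂γ₂ n) * γ₂ₜ ≤ value A (history (Q n) t t≤N))
theorem5p1 ℝ = (λ n → C.Q n) , (λ n → fromℕ 2 ^ p n) , (λ n → fromℕ (p n))
  , (λ n → C.γ₂-Q n , log₂-2^ (p n))
  , (λ n → C.‖Q₀‖∞≈1 n)
  -- The upper constant comes from `p ≤ n`; the lower one from `n ≤ 2 p` and `p ≥ 1`, which give
  -- `n + 1 ≤ 3 p`. The threshold 1 excludes `n = 0`, where the logarithm is 0.
  , (⅓ , 1# , 1 , (⁻¹-nonNeg (fromℕ-nonNeg 3) (fromℕ-suc≉0 2) , 0≉⅓) , (0≤1 , 0≉1)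
    , λ n 1≤n → ⅓N≤p n 1≤n
      , ≤-trans (fromℕ-mono-≤ (ℕ.≤-trans (p≤n n) (ℕ.n≤1+n n))) (≤-reflexive (sym (*-identityˡ _))))
  , λ n A factorizes →
      let i , competitive = C.competitive n A factorizes
      in suc (toℕ i) , ℕ.s≤s ℕ.z≤n , C.s<N n A factorizes i , fromℕ 2 ^ toℕ i
         , C.γ₂-firstRows n (toℕ i) (toℕ<n i) (C.s<N n A factorizes i) , competitive
  where
  open CompleteOrderedField ℝ hiding (zero)
  open OrderedField ℝ
  p : ℕ → ℕ
  p n = mersenne (proj₁ (scale n))

  p≤n : ∀ n → p n ℕ.≤ n
  p≤n n = proj₁ (proj₂ (scale n))

  module C n = Construction ℝ (proj₁ (scale n)) n (p≤n n)

  ⅓ : Carrier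
  ⅓ = fromℕ 3 ⁻¹

  3*⅓≈1 : fromℕ 3 * ⅓ ≈ 1#
  3*⅓≈1 = ⁻¹-inverseʳ (fromℕ 3) (fromℕ-suc≉0 2)

  0≉⅓ : ¬ (0# ≈ ⅓)
  0≉⅓ 0≈⅓ = 0≉1 (trans (sym (zeroʳ _)) (trans (*-congˡ 0≈⅓) 3*⅓≈1))

  1+n≤3p : ∀ n → 1 ℕ.≤ n → suc n ℕ.≤ 3 ℕ.* p n
  1+n≤3p n 1≤n with p n | proj₂ (proj₂ (scale n))
  ... | zero    | n≤0  = contradiction (ℕ.≤-trans 1≤n n≤0) λ ()
  ... | q@(suc _) | n≤2q = ℕ.+-mono-≤ (ℕ.s≤s ℕ.z≤n)
    (ℕ.≤-trans n≤2q (ℕ.+-monoʳ-≤ q (ℕ.m≤m+n q 0)))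

  ⅓N≤p : ∀ n → 1 ℕ.≤ n → ⅓ * fromℕ (suc n) ≤ fromℕ (p n)
  ⅓N≤p n 1≤n = *-cancelˡ-≤ (fromℕ-nonNeg 3) (fromℕ-suc≉0 2) (begin
    fromℕ 3 * (⅓ * fromℕ (suc n)) ≈⟨ *-assoc _ _ _ ⟨
    (fromℕ 3 * ⅓) * fromℕ (suc n) ≈⟨ *-congʳ 3*⅓≈1 ⟩
    1# * fromℕ (suc n)            ≈⟨ *-identityˡ _ ⟩
    fromℕ (suc n)                 ≤⟨ fromℕ-mono-≤ (1+n≤3p n 1≤n) ⟩
    fromℕ (3 ℕ.* p n)             ≈⟨ fromℕ-* 3 (p n) ⟩
    fromℕ 3 * fromℕ (p n)         ∎)
    where
    open PosetReasoning (TotalOrder.poset totalOrder)
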